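{- Let $n,k\ge 1$ be integers. In each adaptive variant of Mastermind with sequence length $n$ and alphabet $[k]=\{1,\dots,k\}$ (black-peg-only or black-peg and white-peg responses; repetitions allowed or, when $n \le k$, not allowed), Knuth's Minimax algorithm identifies any hidden sequence $H$ in at most $nk$ queries.
   Context: Mastermind: let $\mathcal{V}$ be the set of valid sequences. If repetitions are allowed, $\mathcal{V}=[k]^n$. If repetitions are not allowed, $\mathcal{V}$ is the set of $v\in[k]^n$ with pairwise distinct entries. The codemaker fixes a hidden sequence $H=(h_1,\dots,h_n)\in\mathcal{V}$. In each turn $t=1,2,\dots$ the codebreaker submits a query $Q_t\in\mathcal{V}$ and receives the response $\Delta(Q_t,H)$. In the adaptive game $Q_t$ may depend on the earlier responses. The distance function $\Delta$ is one of the following. Black-peg-only: $\Delta(Q,H)=b(Q,H)=|\{i\in\{1,\dots,n\}: q_i=h_i\}|$. Black-peg and white-peg: $\Delta(Q,H)=(b(Q,H),w(Q,H))$, where $w(Q,H)=\max_\sigma b(\sigma(Q),H)-b(Q,H)$ and $\sigma(Q)$ ranges over all rearrangements of the entries of $Q$ by permutations $\sigma$ of the $n$ positions. The remaining solution set after $t$ turns is $S_t=\{h\in\mathcal{V}: \Delta(Q_i,h)=\Delta(Q_i,H)\text{ for all }1\le i\le t\}$, with $S_0=\mathcal{V}$. The hidden sequence is identified after $t$ queries when $|S_t|=1$. Knuth's Minimax algorithm: at each turn $t$ (as long as $H$ has not been identified), assign to each query $Q\in\mathcal{V}$ the score $\max_{r}|\{h\in S_{t-1}:\Delta(Q,h)=r\}|$,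 the maximum being over all responses $r$, and guess a query with minimum score (ties broken arbitrarily). -}

module Defs where

open import Data.Fin.Base using (Fin)
import Data.Fin.Properties as Fin
open import Data.List.Base using (List; []; _∷_; allFin; cartesianProductWith; filter; length; map)
open import Data.List.Extrema.Nat using (max)
open import Data.Nat.Base using (ℕ; zero; suc; _∸_; _≤_; _<_)
open import Data.Nat.Properties using (allUpTo?) renaming (_≟_ to _≟ℕ_)
open import Data.Product.Base using (_×_; _,_)
open import Data.Product.Properties using (≡-dec)
open import Data.Unit.Base using (⊤; tt)
open import Data.Vec.Base using (Vec; []; _∷_; lookup)
import Data.Vec.Base as Vec
open import Data.Vec.Relation.Unary.AllPairs using (allPairs?)
open import Data.Vec.Relation.Unary.Unique.Propositional using (Unique)
open import Relation.Binary.Definitions using (DecidableEquality)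
open import Relation.Binary.PropositionalEquality.Core using (_≡_)
open import Relation.Nullary.Decidable.Core using (Dec; yes; ¬?)
open import Relation.Nullary.Negation.Core using (¬_)

data Repetitions : Set where
  allowed notAllowed : Repetitions

data Feedback : Set where
  black blackWhite : Feedback

-- The alphabet {1,…,k} is represented by Fin k.
Code : ℕ → ℕ → Set
Code n k = Vec (Fin k) n

allCodes : (n k : ℕ) → List (Code n k)
allCodes zero    k = [] ∷ []
allCodes (suc n) k = cartesianProductWith _∷_ (allFin k) (allCodes n k)

unique? : ∀ {n k} (v : Code n k) → Dec (Unique v)
unique? = allPairs? (λ x y → ¬? (x Fin.≟ y))

Valid : Repetitions → ∀ {n k} → Code n k → Set
Valid allowed    v = ⊤
Valid notAllowed v = Unique v

valid? : (ρ : Repetitions) → ∀ {n k} (v : Code n k) → Dec (Valid ρ v)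
valid? allowed    v = yes tt
valid? notAllowed v = unique? v

-- Every valid sequence occurs exactly once in this list, so the length of a
-- filtered sublist is the cardinality of the corresponding subset.
𝒱 : Repetitions → (n k : ℕ) → List (Code n k)
𝒱 ρ n k = filter (valid? ρ) (allCodes n k)

blackPegs : ∀ {n k} → Code n k → Code n k → ℕ
blackPegs {n} q h = length (filter (λ i → lookup q i Fin.≟ lookup h i) (allFin n))

-- A permutation σ of the n positions is given by its table of values
-- σ(0),…,σ(n-1), which are pairwise distinct.
permutations : (n : ℕ) → List (Code n n)
permutations n = filter unique? (allCodes n n)

rearrange : ∀ {n k} → Code n n → Code n k → Code n k
rearrange σ q = Vec.map (lookup q) σ

-- The identity is among the permutations, so neither the default 0 of max nor
-- the truncation of ∸ has any effect.
whitePegs : ∀ {n k} → Code n k → Code n k → ℕ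
whitePegs {n} q h =
  max 0 (map (λ σ → blackPegs (rearrange σ q) h) (permutations n)) ∸ blackPegs q h

Response : Feedback → Set
Response black      = ℕ
Response blackWhite = ℕ × ℕ

_≟ᴿ_ : {φ : Feedback} → DecidableEquality (Response φ)
_≟ᴿ_ {black}      = _≟ℕ_
_≟ᴿ_ {blackWhite} = ≡-dec _≟ℕ_ _≟ℕ_

Δ : (φ : Feedback) → ∀ {n k} → Code n k → Code n k → Response φ
Δ black      q h = blackPegs q h
Δ blackWhite q h = blackPegs q h , whitePegs q h

module Game (φ : Feedback) (ρ : Repetitions) (n k : ℕ) where

  -- The responses that q receives from the valid sequences; any other
  -- response has an empty class and does not affect the maximum.
  responses : Code n k → List (Response φ)
  responses q = map (Δ φ q) (𝒱 ρ n k)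

  score : List (Code n k) → Code n k → ℕ
  score S q =
    max 0 (map (λ r → length (filter (λ h → Δ φ q h ≟ᴿ r) S)) (responses q))

  IsMinimaxGuess : List (Code n k) → Code n k → Set
  IsMinimaxGuess S q = Valid ρ q × (∀ q′ → Valid ρ q′ → score S q ≤ score S q′)

  -- Turns are numbered from 0 here: Q i is the query made after i responses,
  -- so the first t queries are Q 0, …, Q (t-1).
  Consistent : (H : Code n k) (Q : ℕ → Code n k) (t : ℕ) → Code n k → Set
  Consistent H Q t h = ∀ {i} → i < t → Δ φ (Q i) h ≡ Δ φ (Q i) H

  consistent? : ∀ H Q t h → Dec (Consistent H Q t h)
  consistent? H Q t h = allUpTo? (λ i → Δ φ (Q i) h ≟ᴿ Δ φ (Q i) H) t

  remaining : (H : Code n k) (Q : ℕ → Code n k) → ℕ → List (Code n k)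
  remaining H Q t = filter (consistent? H Q t) (𝒱 ρ n k)

  Identified : (H : Code n k) (Q : ℕ → Code n k) → ℕ → Set
  Identified H Q t = length (remaining H Q t) ≡ 1

  -- Q is the query sequence of some run of Knuth's algorithm against H, with
  -- ties broken in any way whatsoever.  The game stops once H is identified;
  -- the later values of Q are irrelevant and left unconstrained.
  IsMinimaxRun : (H : Code n k) (Q : ℕ → Code n k) → Set
  IsMinimaxRun H Q =
    ∀ t → ¬ Identified H Q t → IsMinimaxGuess (remaining H Q t) (Q t)

{-# OPTIONS --safe #-}
module Submission where

-- Let S be the set of remaining codes, s its size and d the dimension of its affine hull, a code
-- being identified with a 0/1 vector of length n k.  A minimax query always splits S, because a
-- query taken from S is alone in its class, and initially d ≤ n (k − 1).
--
-- The number of black pegs is an affine function of the hidden code; without repetitions, so is the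
-- total number of pegs.  A query that splits S by an affine function lowers d, which settles all
-- variants except black and white pegs with repetitions, and that one for n ≤ 2.
--
-- In the remaining variant the total is the maximum of the numbers of black pegs of the
-- rearrangements of the query.  Therefore a response that keeps more than half of S still lowers d,
-- and every other response halves S.  It remains to see that the largest class leaves out a
-- fraction 1 / L of S, where L is about 4 + min(d, k) / n; this makes d + log₂ s minus the sum of
-- log₂ (L / (L − 1)) over the smaller dimensions drop by one in every turn, and a computation shows
-- that it is at most n k initially.
--
-- For the fraction, suppose that every query receives the same response from more than three
-- quarters of S.  Some positions have a majority letter.  Flipping coins between two letters at all
-- other positions shows that typical codes carry all majority letters and no other copies of these
-- two letters.  So the typical response to any query is known, and no position without majority
-- letter can hold a letter that the queries did not notice; about n letters can be packed into one
-- query, hence few queries notice all letters of such a position, and one of them is noticed by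
-- sufficiently many codes.

open import Defs
open import Data.Bool.Base using (if_then_else_)
open import Data.Fin.Base using (Fin; suc; zero)
import Data.Fin.Properties as Fin
open import Data.Integer.Base as ℤ using (0ℤ; 1ℤ; ℤ) renaming (+_ to pos)
import Data.Integer.Properties as ℤ
import Data.Integer.Tactic.RingSolver as ℤSolver
open import Data.List.Base using (List; []; _++_; _∷_; allFin; cartesianProductWith; filter; length; map; replicate; tabulate)
open import Data.List.Extrema.Nat using (argmax-sel; max; max<v⁺; max≤v⁺; v≤max⁺; xs≤max)
open import Data.List.Membership.Propositional using (_∈_; find; lose)
open import Data.List.Membership.Propositional.Properties using (∈-++⁺ˡ; ∈-++⁻; ∈-allFin; ∈-cartesianProductWith⁺; ∈-filter⁺; ∈-filter⁻; ∈-map⁺; ∈-map⁻; ∈-∃++)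
open import Data.List.Properties using (filter-accept; filter-reject; length-++; length-filter; length-map; length-replicate; length-tabulate)
import Data.List.Relation.Binary.Permutation.Propositional as ↭
open import Data.List.Relation.Binary.Permutation.Propositional using (_↭_; prep; swap; ↭-refl; ↭-sym; ↭-trans)
open import Data.List.Relation.Binary.Permutation.Propositional.Properties using (shift; ↭-length)
open import Data.List.Relation.Binary.Subset.Propositional using (_⊆_)
open import Data.List.Relation.Unary.All as All using (All; []; _∷_)
import Data.List.Relation.Unary.All.Properties as All
open import Data.List.Relation.Unary.AllPairs as AllPairs using (AllPairs; []; _∷_)
import Data.List.Relation.Unary.AllPairs.Properties as AllPairs
open import Data.List.Relation.Unary.Any as Any using (Any; here; there)
import Data.List.Relation.Unary.Any.Properties as Any
import Data.List.Relation.Unary.Unique.Propositional as List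
import Data.List.Relation.Unary.Unique.Propositional.Properties as Unique
open import Data.Maybe.Base using (Maybe; just; nothing)
import Data.Maybe.Properties as Maybe
open import Data.Nat.Base
open import Data.Nat.DivMod using (+-distrib-/-∣ʳ; /-monoˡ-≤; m%n<n; m*n/n≡m; m/n*n≤m; m<n⇒m/n≡0; m≡m%n+[m/n]*n)
open import Data.Nat.Properties
open import Data.Nat.Tactic.RingSolver using (solve-∀)
open import Data.Product.Base using (_,_; _×_; proj₁; proj₂; ∃-syntax)
open import Data.Sum.Base using ([_,_]′; _⊎_; inj₁; inj₂)
open import Data.Unit.Base using (tt)
open import Data.Vec.Base as Vec using (Vec; []; _[_]≔_; _∷_; lookup; toList)
open import Data.Vec.Properties using ([]≔-lookup; insertAt-lookup; lookup-map; lookup-replicate; lookup∘tabulate; tabulate-cong; tabulate∘lookup)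
open import Data.Vec.Relation.Unary.All using ([]; _∷_)
import Data.Vec.Relation.Unary.All.Properties as VAll
open import Data.Vec.Relation.Unary.AllPairs using ([]; _∷_)
open import Data.Vec.Relation.Unary.Unique.Propositional using (Unique)
open import Data.Vec.Relation.Unary.Unique.Propositional.Properties using (lookup-injective)
open import Function.Base using (_∘_; id)
open import Relation.Binary.Definitions using (tri<; tri>; tri≈)
open import Relation.Binary.PropositionalEquality
open import Relation.Nullary
open import Relation.Nullary.Decidable using (_×-dec_; _⊎-dec_; decidable-stable; ¬?)
open import Relation.Unary using (Decidable)

-- Counting

ι : {X : Set} → Dec X → ℕ
ι d = if does d then 1 else 0

ι-yes : {X : Set} (d : Dec X) → X → ι d ≡ 1
ι-yes (yes _) x = refl
ι-yes (no ¬x) x = contradiction x ¬x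

ι-no : {X : Set} (d : Dec X) → ¬ X → ι d ≡ 0
ι-no (yes x) ¬x = contradiction x ¬x
ι-no (no _)  ¬x = refl

ι≤1 : {X : Set} (d : Dec X) → ι d ≤ 1
ι≤1 (yes _) = ≤-refl
ι≤1 (no _)  = z≤n

ι-mono : {X Y : Set} (d : Dec X) (e : Dec Y) → (X → Y) → ι d ≤ ι e
ι-mono (yes x) e f = ≤-reflexive (sym (ι-yes e (f x)))
ι-mono (no _)  e f = z≤n

ι-cong : {X Y : Set} (d : Dec X) (e : Dec Y) → (X → Y) → (Y → X) → ι d ≡ ι e
ι-cong d e f g = ≤-antisym (ι-mono d e f) (ι-mono e d g)

rearrange-+ : ∀ a b c d → (a + b) + (c + d) ≡ (a + c) + (b + d)
rearrange-+ = solve-∀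

sumL : {A : Set} → (A → ℕ) → List A → ℕ
sumL f []       = 0
sumL f (x ∷ xs) = f x + sumL f xs

sumL-mono : ∀ {A : Set} {f g : A → ℕ} xs → (∀ {x} → x ∈ xs → f x ≤ g x) → sumL f xs ≤ sumL g xs
sumL-mono []       le = z≤n
sumL-mono (x ∷ xs) le = +-mono-≤ (le (here refl)) (sumL-mono xs (le ∘ there))

sumL-mono-< : ∀ {A : Set} {f g : A → ℕ} {x} xs → (∀ {y} → y ∈ xs → f y ≤ g y) → x ∈ xs → f x < g x →
  sumL f xs < sumL g xs
sumL-mono-< (x ∷ xs) le (here refl) lt = +-mono-<-≤ lt (sumL-mono xs (le ∘ there))
sumL-mono-< (x ∷ xs) le (there m)   lt = +-mono-≤-< (le (here refl)) (sumL-mono-< xs (le ∘ there) m lt)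

sumL-cong : ∀ {A : Set} {f g : A → ℕ} xs → (∀ {x} → x ∈ xs → f x ≡ g x) → sumL f xs ≡ sumL g xs
sumL-cong xs eq = ≤-antisym (sumL-mono xs (≤-reflexive ∘ eq)) (sumL-mono xs (≤-reflexive ∘ sym ∘ eq))

sumL-+ : ∀ {A : Set} (f g : A → ℕ) xs → sumL (λ x → f x + g x) xs ≡ sumL f xs + sumL g xs
sumL-+ f g []       = refl
sumL-+ f g (x ∷ xs) rewrite sumL-+ f g xs = rearrange-+ (f x) (g x) (sumL f xs) (sumL g xs)

sumL-* : ∀ {A : Set} c (f : A → ℕ) xs → sumL (λ x → c * f x) xs ≡ c * sumL f xs
sumL-* c f []       = sym (*-zeroʳ c)
sumL-* c f (x ∷ xs) rewrite sumL-* c f xs = sym (*-distribˡ-+ c (f x) (sumL f xs))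

sumL-const : ∀ {A : Set} c (xs : List A) → sumL (λ _ → c) xs ≡ length xs * c
sumL-const c []       = refl
sumL-const c (x ∷ xs) = cong (c +_) (sumL-const c xs)

sumL-comm : ∀ {A B : Set} (f : A → B → ℕ) xs ys →
  sumL (λ x → sumL (f x) ys) xs ≡ sumL (λ y → sumL (λ x → f x y) xs) ys
sumL-comm f []       ys = sym (trans (sumL-const 0 ys) (*-zeroʳ (length ys)))
sumL-comm f (x ∷ xs) ys rewrite sumL-comm f xs ys = sym (sumL-+ (f x) _ ys)

sumL-++ : ∀ {A : Set} (f : A → ℕ) xs ys → sumL f (xs ++ ys) ≡ sumL f xs + sumL f ys
sumL-++ f []       ys = refl
sumL-++ f (x ∷ xs) ys rewrite sumL-++ f xs ys = sym (+-assoc (f x) _ _)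

sumL-map : ∀ {A B : Set} (f : B → ℕ) (g : A → B) xs → sumL f (map g xs) ≡ sumL (f ∘ g) xs
sumL-map f g []       = refl
sumL-map f g (x ∷ xs) = cong (f (g x) +_) (sumL-map f g xs)

count : {A : Set} {P : A → Set} → Decidable P → List A → ℕ
count P? = sumL (λ x → ι (P? x))

count≡length-filter : {A : Set} {P : A → Set} → (P? : Decidable P) (xs : List A) → length (filter P? xs) ≡ count P? xs
count≡length-filter P? []       = refl
count≡length-filter P? (x ∷ xs) with P? x
... | yes _ = cong suc (count≡length-filter P? xs)
... | no  _ = count≡length-filter P? xs

count-mono : {A : Set} {P Q : A → Set} → (P? : Decidable P) (Q? : Decidable Q) (xs : List A) →
  (∀ {x} → x ∈ xs → P x → Q x) → count P? xs ≤ count Q? xs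
count-mono P? Q? xs imp = sumL-mono xs (λ {x} m → ι-mono (P? x) (Q? x) (imp m))

count-∪ : {A : Set} {P Q R : A → Set} → (P? : Decidable P) (Q? : Decidable Q) (R? : Decidable R) (xs : List A) →
  (∀ {x} → x ∈ xs → P x → Q x ⊎ R x) → count P? xs ≤ count Q? xs + count R? xs
count-∪ P? Q? R? xs imp = ≤-trans (sumL-mono xs (λ m → aux m)) (≤-reflexive (sumL-+ _ _ xs))
  where
  aux : ∀ {x} → x ∈ xs → ι (P? x) ≤ ι (Q? x) + ι (R? x)
  aux {x} m with P? x
  ... | no _ = z≤n
  ... | yes p with imp m p
  ...   | inj₁ q = ≤-trans (≤-reflexive (sym (ι-yes (Q? x) q))) (m≤m+n _ _)
  ...   | inj₂ r = ≤-trans (≤-reflexive (sym (ι-yes (R? x) r))) (m≤n+m _ _)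

count-¬ : {A : Set} {P : A → Set} → (P? : Decidable P) (xs : List A) → count P? xs + count (¬? ∘ P?) xs ≡ length xs
count-¬ P? xs = trans (sym (sumL-+ _ _ xs)) (trans (sumL-cong xs (λ {x} _ → aux x)) (trans (sumL-const 1 xs) (*-identityʳ _)))
  where
  aux : ∀ x → ι (P? x) + ι (¬? (P? x)) ≡ 1
  aux x with P? x
  ... | yes _ = refl
  ... | no  _ = refl

count-∃ : {A : Set} {P : A → Set} → (P? : Decidable P) (xs : List A) → 0 < count P? xs → ∃[ x ] (x ∈ xs × P x)
count-∃ P? (x ∷ xs) lt with P? x
... | yes p = x , here refl , p
... | no  _ with count-∃ P? xs lt
...   | y , m , p = y , there m , p

count-∈ : {A : Set} {P : A → Set} → (P? : Decidable P) {xs : List A} {x : A} → x ∈ xs → P x → 0 < count P? xs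
count-∈ P? {x ∷ xs} (here refl) p rewrite ι-yes (P? x) p = s≤s z≤n
count-∈ P? {y ∷ xs} (there m)   p = ≤-trans (count-∈ P? m p) (m≤n+m _ _)

avoid : {A : Set} {P : A → Set} → (P? : Decidable P) (xs : List A) → count P? xs < length xs → ∃[ x ] (x ∈ xs × ¬ P x)
avoid P? xs lt = count-∃ (¬? ∘ P?) xs
  (+-cancelˡ-< (count P? xs) _ _ (subst₂ _<_ (sym (+-identityʳ _)) (sym (count-¬ P? xs)) lt))

avoid₂ : {A : Set} {P Q : A → Set} → (P? : Decidable P) (Q? : Decidable Q) (xs : List A) →
  count P? xs + count Q? xs < length xs → ∃[ x ] (x ∈ xs × ¬ P x × ¬ Q x)
avoid₂ P? Q? xs lt with avoid (λ x → P? x ⊎-dec Q? x) xs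
                          (≤-<-trans (count-∪ (λ x → P? x ⊎-dec Q? x) P? Q? xs (λ _ → id)) lt)
... | x , m , ¬pq = x , m , ¬pq ∘ inj₁ , ¬pq ∘ inj₂

avoid₃ : {A : Set} {P Q R : A → Set} → (P? : Decidable P) (Q? : Decidable Q) (R? : Decidable R) (xs : List A) →
  count P? xs + (count Q? xs + count R? xs) < length xs → ∃[ x ] (x ∈ xs × ¬ P x × ¬ Q x × ¬ R x)
avoid₃ P? Q? R? xs lt with avoid₂ P? (λ x → Q? x ⊎-dec R? x) xs
    (≤-<-trans (+-monoʳ-≤ (count P? xs) (count-∪ (λ x → Q? x ⊎-dec R? x) Q? R? xs (λ _ → id))) lt)
... | x , m , ¬p , ¬qr = x , m , ¬p , ¬qr ∘ inj₁ , ¬qr ∘ inj₂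

count-< : {A : Set} {P Q : A → Set} → (P? : Decidable P) (Q? : Decidable Q) {x : A} (xs : List A) →
  (∀ {y} → y ∈ xs → P y → Q y) → x ∈ xs → ¬ P x → Q x → count P? xs < count Q? xs
count-< P? Q? {x} xs imp m ¬p q = sumL-mono-< xs (λ {y} m → ι-mono (P? y) (Q? y) (imp m)) m
  (subst₂ _<_ (sym (ι-no (P? x) ¬p)) (sym (ι-yes (Q? x) q)) (s≤s z≤n))

sumF : ∀ k → (Fin k → ℕ) → ℕ
sumF zero    f = 0
sumF (suc k) f = f zero + sumF k (f ∘ suc)

sumF-mono : ∀ k {f g : Fin k → ℕ} → (∀ c → f c ≤ g c) → sumF k f ≤ sumF k g
sumF-mono zero    le = z≤n
sumF-mono (suc k) le = +-mono-≤ (le zero) (sumF-mono k (le ∘ suc))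

sumF-mono-< : ∀ k {f g : Fin k → ℕ} → (∀ c → f c ≤ g c) → ∀ c → f c < g c → sumF k f < sumF k g
sumF-mono-< (suc k) le zero    lt = +-mono-<-≤ lt (sumF-mono k (le ∘ suc))
sumF-mono-< (suc k) le (suc c) lt = +-mono-≤-< (le zero) (sumF-mono-< k (le ∘ suc) c lt)

sumF-cong : ∀ k {f g : Fin k → ℕ} → (∀ c → f c ≡ g c) → sumF k f ≡ sumF k g
sumF-cong zero    eq = refl
sumF-cong (suc k) eq = cong₂ _+_ (eq zero) (sumF-cong k (eq ∘ suc))

sumF-+ : ∀ k (f g : Fin k → ℕ) → sumF k (λ c → f c + g c) ≡ sumF k f + sumF k g
sumF-+ zero    f g = refl
sumF-+ (suc k) f g rewrite sumF-+ k (f ∘ suc) (g ∘ suc) = rearrange-+ (f zero) (g zero) _ _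

sumF-0 : ∀ k → sumF k (λ _ → 0) ≡ 0
sumF-0 zero    = refl
sumF-0 (suc k) = sumF-0 k

sumF-const : ∀ k c → sumF k (λ _ → c) ≡ k * c
sumF-const zero    c = refl
sumF-const (suc k) c = cong (c +_) (sumF-const k c)

sumF-δ : ∀ k (f : Fin k → ℕ) x → sumF k (λ c → ι (c Fin.≟ x) * f c) ≡ f x
sumF-δ (suc k) f zero    = trans (cong₂ _+_ (+-identityʳ (f zero)) (sumF-0 k)) (+-identityʳ _)
sumF-δ (suc k) f (suc x) = trans (sumF-cong k (λ c → cong (_* f (suc c)) (ι-cong (suc c Fin.≟ suc x) (c Fin.≟ x) Fin.suc-injective (cong suc)))) (sumF-δ k (f ∘ suc) x)

sumF-δ1 : ∀ k (x : Fin k) → sumF k (λ c → ι (c Fin.≟ x)) ≡ 1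
sumF-δ1 k x = trans (sumF-cong k (λ c → sym (*-identityʳ _))) (sumF-δ k (λ _ → 1) x)

f≤sumF : ∀ k (f : Fin k → ℕ) x → f x ≤ sumF k f
f≤sumF (suc k) f zero    = m≤m+n _ _
f≤sumF (suc k) f (suc x) = ≤-trans (f≤sumF k (f ∘ suc) x) (m≤n+m _ _)

-- Linear algebra over ℤ

dot : ∀ {N} → Vec ℤ N → Vec ℤ N → ℤ
dot []       []       = 0ℤ
dot (x ∷ xs) (y ∷ ys) = x ℤ.* y ℤ.+ dot xs ys

dot-++ : ∀ {M N} (xs zs : Vec ℤ M) (ys ws : Vec ℤ N) →
  dot (xs Vec.++ ys) (zs Vec.++ ws) ≡ dot xs zs ℤ.+ dot ys ws
dot-++ []       []       ys ws = sym (ℤ.+-identityˡ _)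
dot-++ (x ∷ xs) (z ∷ zs) ys ws = trans (cong (λ t → x ℤ.* z ℤ.+ t) (dot-++ xs zs ys ws)) (sym (ℤ.+-assoc (x ℤ.* z) _ _))

combine : ∀ {N} → ℤ → ℤ → Vec ℤ N → Vec ℤ N → Vec ℤ N
combine a b = Vec.zipWith (λ x y → a ℤ.* y ℤ.- b ℤ.* x)

dot-combine : ∀ {N} a b (u u′ v : Vec ℤ N) →
  dot (combine a b u u′) v ≡ a ℤ.* dot u′ v ℤ.- b ℤ.* dot u v
dot-combine a b []      []       []      = lemma a b
  where
  lemma : ∀ a b → 0ℤ ≡ a ℤ.* 0ℤ ℤ.- b ℤ.* 0ℤ
  lemma = ℤSolver.solve-∀
dot-combine a b (x ∷ u) (y ∷ u′) (z ∷ v) rewrite dot-combine a b u u′ v = lemma a b x y z (dot u v) (dot u′ v)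
  where
  lemma : ∀ a b x y z p q → (a ℤ.* y ℤ.- b ℤ.* x) ℤ.* z ℤ.+ (a ℤ.* q ℤ.- b ℤ.* p)
                          ≡ a ℤ.* (y ℤ.* z ℤ.+ q) ℤ.- b ℤ.* (x ℤ.* z ℤ.+ p)
  lemma = ℤSolver.solve-∀

System : ℕ → Set
System N = List (Vec ℤ N × Vec ℤ N)

Diagonal : ∀ {N} → Vec ℤ N × Vec ℤ N → Set
Diagonal (u , v) = dot u v ≢ 0ℤ

Annihilates : ∀ {N} → Vec ℤ N → Vec ℤ N × Vec ℤ N → Set
Annihilates u (_ , v) = dot u v ≡ 0ℤ

reduce : ∀ {N} → ℤ → Vec ℤ N → Vec ℤ (suc N) × Vec ℤ (suc N) → Vec ℤ N × Vec ℤ N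
reduce a u (b ∷ u′ , _ ∷ v) = combine a b u u′ , v

-- One step of Gaussian elimination: the first pair whose functional involves
-- the first coordinate is used up to remove that coordinate.
eliminate : ∀ {N} → System (suc N) → System N
eliminate [] = []
eliminate ((a ∷ u , c ∷ v) ∷ xs) with a ℤ.≟ 0ℤ
... | yes _ = (u , v) ∷ eliminate xs
... | no  _ = map (reduce a u) xs

length-eliminate : ∀ {N} (xs : System (suc N)) → length xs ≤ suc (length (eliminate xs))
length-eliminate [] = z≤n
length-eliminate ((a ∷ u , c ∷ v) ∷ xs) with a ℤ.≟ 0ℤ
... | yes _ = s≤s (length-eliminate xs)
... | no  _ = s≤s (≤-reflexive (sym (length-map (reduce a u) xs)))

0*+ : ∀ x y → 0ℤ ℤ.* x ℤ.+ y ≡ y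
0*+ x y = trans (cong (ℤ._+ y) (ℤ.*-zeroˡ x)) (ℤ.+-identityˡ y)

Annihilates-eliminate : ∀ {N} (u : Vec ℤ N) xs → All (Annihilates (0ℤ ∷ u)) xs →
  All (Annihilates u) (eliminate xs)
Annihilates-eliminate u [] [] = []
Annihilates-eliminate u ((a ∷ w , c ∷ v) ∷ xs) (p ∷ ps) with a ℤ.≟ 0ℤ
... | yes _ = trans (sym (0*+ c (dot u v))) p ∷ Annihilates-eliminate u xs ps
... | no  _ = All.map⁺ (All.map (λ { {(b ∷ u′ , c′ ∷ v′)} q → trans (sym (0*+ c′ (dot u v′))) q }) ps)

-- The functional `a ∷ u` vanishes on the vector, so subtracting a multiple of it leaves only the
-- factor `a`.
reduce-dot : ∀ {N} a (u : Vec ℤ N) b u′ c v → dot (a ∷ u) (c ∷ v) ≡ 0ℤ →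
  dot (combine a b u u′) v ≡ a ℤ.* dot (b ∷ u′) (c ∷ v)
reduce-dot a u b u′ c v eq = trans (dot-combine a b u u′ v)
  (trans (lemma a b c (dot u v) (dot u′ v)) (trans (cong (λ t → a ℤ.* (b ℤ.* c ℤ.+ dot u′ v) ℤ.- b ℤ.* t) eq) (lemma₂ _ b)))
  where
  lemma : ∀ a b c p q → a ℤ.* q ℤ.- b ℤ.* p ≡ a ℤ.* (b ℤ.* c ℤ.+ q) ℤ.- b ℤ.* (a ℤ.* c ℤ.+ p)
  lemma = ℤSolver.solve-∀
  lemma₂ : ∀ x b → x ℤ.- b ℤ.* 0ℤ ≡ x
  lemma₂ = ℤSolver.solve-∀

Diagonal-eliminate : ∀ {N} (xs : System (suc N)) →
  All Diagonal xs → AllPairs (λ x y → Annihilates (proj₁ x) y) xs → All Diagonal (eliminate xs)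
Diagonal-eliminate [] [] [] = []
Diagonal-eliminate ((a ∷ u , c ∷ v) ∷ xs) (d ∷ ds) (p ∷ ps) with a ℤ.≟ 0ℤ
... | yes refl = (λ eq → d (trans (0*+ c (dot u v)) eq)) ∷ Diagonal-eliminate xs ds ps
... | no a≢0 = All.map⁺ (All.zipWith (λ { {(b ∷ u′ , c′ ∷ v′)} (q , d′) eq →
        d′ (ℤ.*-cancelˡ-≡ a _ _ {{ℤ.≢-nonZero a≢0}} (trans (sym (reduce-dot a u b u′ c′ v′ q)) (trans eq (sym (ℤ.*-zeroʳ a))))) }) (p , ds))

triangular-eliminate : ∀ {N} (xs : System (suc N)) →
  AllPairs (λ x y → Annihilates (proj₁ x) y) xs → AllPairs (λ x y → Annihilates (proj₁ x) y) (eliminate xs)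
triangular-eliminate [] [] = []
triangular-eliminate ((a ∷ u , c ∷ v) ∷ xs) (p ∷ ps) with a ℤ.≟ 0ℤ
... | yes refl = Annihilates-eliminate u xs p ∷ triangular-eliminate xs ps
... | no a≢0 = go xs p ps
  where
  go : ∀ xs → All (Annihilates (a ∷ u)) xs → AllPairs (λ x y → Annihilates (proj₁ x) y) xs →
       AllPairs (λ x y → Annihilates (proj₁ x) y) (map (reduce a u) xs)
  go [] [] [] = []
  go ((b ∷ u′ , c′ ∷ v′) ∷ xs) (q ∷ qs) (r ∷ rs) =
    All.map⁺ (All.zipWith (λ { {(b″ ∷ u″ , c″ ∷ v″)} (q′ , r′) →
      trans (reduce-dot a u b u′ c″ v″ q′) (trans (cong (a ℤ.*_) r′) (ℤ.*-zeroʳ a)) }) (qs , r)) ∷ go xs qs rs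

-- The values of the functionals on the vectors form a triangular matrix with nonzero diagonal. An
-- elimination removes one coordinate, costs at most one pair and keeps this shape.
triangular-bound : ∀ {N} (xs : System N) → All Diagonal xs →
  AllPairs (λ x y → Annihilates (proj₁ x) y) xs → length xs ≤ N
triangular-bound {zero}  [] _ _ = z≤n
triangular-bound {zero}  (([] , []) ∷ xs) (d ∷ _) _ = contradiction refl d
triangular-bound {suc N} xs ds ps = ≤-trans (length-eliminate xs)
  (s≤s (triangular-bound (eliminate xs) (Diagonal-eliminate xs ds ps) (triangular-eliminate xs ps)))

Functional : ℕ → ℕ → Set
Functional n k = Fin n → Fin k → ℤ

eval : ∀ {n k} → Functional n k → Code n k → ℤ
eval w []      = 0ℤ
eval w (c ∷ h) = w zero c ℤ.+ eval (w ∘ suc) h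

-- Coordinates of a code in which the letter zero of each position is dropped.
unit : ∀ {k} → Fin (suc k) → Vec ℤ k
unit zero    = Vec.replicate _ 0ℤ
unit (suc c) = Vec.tabulate (λ d → pos (ι (d Fin.≟ c)))

coords : ∀ {n k} → Code n (suc k) → Vec ℤ (n * k)
coords []      = []
coords (c ∷ h) = unit c Vec.++ coords h

coeffs : ∀ {n k} → Functional n (suc k) → Vec ℤ (n * k)
coeffs {zero}  w = []
coeffs {suc n} w = Vec.tabulate (λ c → w zero (suc c) ℤ.- w zero zero) Vec.++ coeffs (w ∘ suc)

dot-zeros : ∀ {k} (v : Vec ℤ k) → dot v (Vec.replicate _ 0ℤ) ≡ 0ℤ
dot-zeros []      = refl
dot-zeros (x ∷ v) = cong₂ ℤ._+_ (ℤ.*-zeroʳ x) (dot-zeros v)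

dot-unit : ∀ {k} (f : Fin k → ℤ) c → dot (Vec.tabulate f) (Vec.tabulate (λ d → pos (ι (d Fin.≟ c)))) ≡ f c
dot-unit {suc k} f zero    = trans (cong₂ ℤ._+_ (ℤ.*-identityʳ (f zero)) (zeros (f ∘ suc))) (ℤ.+-identityʳ (f zero))
  where
  zeros : ∀ {m} (g : Fin m → ℤ) → dot (Vec.tabulate g) (Vec.tabulate (λ _ → 0ℤ)) ≡ 0ℤ
  zeros {zero}  g = refl
  zeros {suc m} g = cong₂ ℤ._+_ (ℤ.*-zeroʳ (g zero)) (zeros (g ∘ suc))
dot-unit {suc k} f (suc c) = trans (cong₂ ℤ._+_ (ℤ.*-zeroʳ (f zero))
    (trans (cong (dot (Vec.tabulate (f ∘ suc))) (tabulate-cong (λ d → cong pos (ι-cong (suc d Fin.≟ suc c) (d Fin.≟ c) Fin.suc-injective (cong suc))))) (dot-unit (f ∘ suc) c)))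
  (ℤ.+-identityˡ _)

origin : ∀ {n k} → Functional n (suc k) → ℤ
origin {zero}  w = 0ℤ
origin {suc n} w = w zero zero ℤ.+ origin (w ∘ suc)

-- Every position carries exactly one letter, so the weight of the letter `zero` can be moved into
-- the constant `origin`. This saves one coordinate per position.
dot-coords : ∀ {n k} (w : Functional n (suc k)) (h : Code n (suc k)) →
  eval w h ≡ origin w ℤ.+ dot (coeffs w) (coords h)
dot-coords w [] = refl
dot-coords {suc n} {k} w (c ∷ h) =
  trans (cong₂ ℤ._+_ (head c) (dot-coords (w ∘ suc) h))
  (trans (lemma (w zero zero) (dot ws (unit c)) (origin (w ∘ suc)) (dot (coeffs (w ∘ suc)) (coords h)))
         (cong (λ t → origin w ℤ.+ t) (sym (dot-++ ws (unit c) (coeffs (w ∘ suc)) (coords h)))))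
  where
  ws = Vec.tabulate (λ c → w zero (suc c) ℤ.- w zero zero)
  head : ∀ c → w zero c ≡ w zero zero ℤ.+ dot ws (unit c)
  head zero    = sym (trans (cong (λ t → w zero zero ℤ.+ t) (dot-zeros ws)) (ℤ.+-identityʳ _))
  head (suc c) = trans (lemma′ (w zero (suc c)) (w zero zero))
                       (cong (λ t → w zero zero ℤ.+ t) (sym (dot-unit (λ c → w zero (suc c) ℤ.- w zero zero) c)))
    where
    lemma′ : ∀ x y → x ≡ y ℤ.+ (x ℤ.- y)
    lemma′ = ℤSolver.solve-∀
  lemma : ∀ a b c d → (a ℤ.+ b) ℤ.+ (c ℤ.+ d) ≡ (a ℤ.+ c) ℤ.+ (b ℤ.+ d)
  lemma = ℤSolver.solve-∀

Triangular : ∀ {n k} → List (Code n k) → Code n k → List (Functional n k × Code n k) → Set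
Triangular S h₀ ps =
  All (λ p → proj₂ p ∈ S × eval (proj₁ p) (proj₂ p) ≢ eval (proj₁ p) h₀) ps ×
  AllPairs (λ p q → eval (proj₁ p) (proj₂ q) ≡ eval (proj₁ p) h₀) ps

-- The affine hull of S has dimension at most d.  Stated through triangular systems, it needs
-- neither bases nor division.
RankLe : ∀ {n k} → List (Code n k) → ℕ → Set
RankLe S d = ∀ {h₀} → h₀ ∈ S → ∀ ps → Triangular S h₀ ps → length ps ≤ d

-- Subtracting the coordinates of the base point `h₀` turns a triangular system into one of linear
-- functionals on `n * k` coordinates.
rank-total : ∀ {n k} (S : List (Code n (suc k))) → RankLe S (n * k)
rank-total {n} {k} S {h₀} _ ps (ds , ts) =
  subst (_≤ n * k) (length-map embed ps)
    (triangular-bound (map embed ps)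
      (All.map⁺ (All.map (λ { {(w , h)} (_ , neq) eq → neq (back w h eq) }) ds))
      (AllPairs.map⁺ (AllPairs.map (λ { {(w , h)} {(w′ , h′)} eq → trans (eval-diff w h′) (ℤ.i≡j⇒i-j≡0 eq) }) ts)))
  where
  diff : Code n (suc k) → Vec ℤ (n * k)
  diff h = combine 1ℤ 1ℤ (coords h₀) (coords h)
  embed : Functional n (suc k) × Code n (suc k) → Vec ℤ (n * k) × Vec ℤ (n * k)
  embed (w , h) = coeffs w , diff h
  dot-comm : ∀ {N} (u v : Vec ℤ N) → dot u v ≡ dot v u
  dot-comm []      []      = refl
  dot-comm (x ∷ u) (y ∷ v) = cong₂ ℤ._+_ (ℤ.*-comm x y) (dot-comm u v)
  lemma : ∀ o p q → 1ℤ ℤ.* p ℤ.- 1ℤ ℤ.* q ≡ (o ℤ.+ p) ℤ.- (o ℤ.+ q)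
  lemma = ℤSolver.solve-∀
  eval-diff : ∀ w h → dot (coeffs w) (diff h) ≡ eval w h ℤ.- eval w h₀
  eval-diff w h = trans (dot-comm (coeffs w) (diff h)) (trans (dot-combine 1ℤ 1ℤ (coords h₀) (coords h) (coeffs w))
    (trans (lemma (origin w) (dot (coords h) (coeffs w)) (dot (coords h₀) (coeffs w)))
      (cong₂ ℤ._-_ (trans (cong (λ t → origin w ℤ.+ t) (dot-comm (coords h) (coeffs w))) (sym (dot-coords w h)))
                   (trans (cong (λ t → origin w ℤ.+ t) (dot-comm (coords h₀) (coeffs w))) (sym (dot-coords w h₀))))))
  back : ∀ w h → dot (coeffs w) (diff h) ≡ 0ℤ → eval w h ≡ eval w h₀
  back w h eq = ℤ.i-j≡0⇒i≡j _ _ (trans (sym (eval-diff w h)) eq)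

-- At least one of `g` and `g′` differs in value from the base point of a triangular system for `C`.
-- Put in front together with `w`, which is constant on `C`, it gives a system for `S` that is
-- longer by one.
rank-drop : ∀ {n k d} {S C : List (Code n k)} (w : Functional n k) → RankLe S d → C ⊆ S →
  (∀ {h h′} → h ∈ C → h′ ∈ C → eval w h ≡ eval w h′) →
  ∀ {g g′} → g ∈ S → g′ ∈ S → eval w g ≢ eval w g′ →
  ∃[ d′ ] (d ≡ suc d′ × RankLe C d′)
rank-drop {d = zero} w rk C⊆S same {g} {g′} g∈ g′∈ neq with () ← rk g′∈ ((w , g) ∷ []) (((g∈ , neq) ∷ []) , ([] ∷ []))
rank-drop {n} {k} {suc d} {S} {C} w rk C⊆S same {g} {g′} g∈ g′∈ neq = d , refl , λ {h₀} → bound {h₀}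
  where
  bound : RankLe C d
  bound {h₀} h₀∈ ps (ds , ts) = s≤s⁻¹ (extend (eval w g ℤ.≟ eval w h₀))
    where
    ps′ : All (λ p → proj₂ p ∈ S × eval (proj₁ p) (proj₂ p) ≢ eval (proj₁ p) h₀) ps
    ps′ = All.map (λ (m , ne) → C⊆S m , ne) ds
    first : All (λ q → eval w (proj₂ q) ≡ eval w h₀) ps
    first = All.map (λ (m , _) → same m h₀∈) ds
    extend : Dec (eval w g ≡ eval w h₀) → suc (length ps) ≤ suc d
    extend (no ne)  = rk (C⊆S h₀∈) ((w , g) ∷ ps) ((g∈ , ne) ∷ ps′ , first ∷ ts)
    extend (yes eq) = rk (C⊆S h₀∈) ((w , g′) ∷ ps) ((g′∈ , λ eq′ → neq (trans eq (sym eq′))) ∷ ps′ , first ∷ ts)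

rank-⊆ : ∀ {n k d} {S C : List (Code n k)} → RankLe S d → C ⊆ S → RankLe C d
rank-⊆ rk C⊆S h₀∈ ps (ds , ts) = rk (C⊆S h₀∈) ps (All.map (λ (m , ne) → C⊆S m , ne) ds , ts)

-- Pegs

matches : ∀ {n k} → Code n k → Code n k → ℕ
matches {n} Q h = sumF n (λ i → ι (lookup Q i Fin.≟ lookup h i))

occ : ∀ {n k} → Fin k → Code n k → ℕ
occ {n} c v = sumF n (λ i → ι (lookup v i Fin.≟ c))

-- The size of the intersection of the two multisets of letters.
common : ∀ {n k} → Code n k → Code n k → ℕ
common {n} {k} Q h = sumF k (λ c → occ c Q ⊓ occ c h)

-- Black and white pegs together, in the form that occurs in `whitePegs`.
total : ∀ {n k} → Code n k → Code n k → ℕ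
total {n} Q h = max 0 (map (λ σ → blackPegs (rearrange σ Q) h) (permutations n))

sumL-tabulate : ∀ {A : Set} (f : A → ℕ) n (g : Fin n → A) → sumL f (tabulate g) ≡ sumF n (f ∘ g)
sumL-tabulate f zero    g = refl
sumL-tabulate f (suc n) g = cong (f (g zero) +_) (sumL-tabulate f n (g ∘ suc))

blackPegs≡matches : ∀ {n k} (Q h : Code n k) → blackPegs Q h ≡ matches Q h
blackPegs≡matches {n} Q h = trans (count≡length-filter (λ i → lookup Q i Fin.≟ lookup h i) (allFin n))
  (sumL-tabulate _ n id)

allCodes-complete : ∀ {n k} (v : Code n k) → v ∈ allCodes n k
allCodes-complete []      = here refl
allCodes-complete (c ∷ v) = ∈-cartesianProductWith⁺ _∷_ (∈-allFin c) (allCodes-complete v)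

sumF-comm : ∀ m n (f : Fin m → Fin n → ℕ) →
  sumF m (λ i → sumF n (f i)) ≡ sumF n (λ j → sumF m (λ i → f i j))
sumF-comm zero    n f = sym (sumF-0 n)
sumF-comm (suc m) n f rewrite sumF-comm m n (f ∘ suc) = sym (sumF-+ n (f zero) _)

occ-∑ : ∀ {n k} (f : Fin k → ℕ) (v : Code n k) → sumF n (f ∘ lookup v) ≡ sumF k (λ c → occ c v * f c)
occ-∑ {n} {k} f v = trans (sumF-cong n (λ i → sym (trans (sumF-cong k (λ c → cong (_* f c) (ι-cong (lookup v i Fin.≟ c) (c Fin.≟ lookup v i) sym sym))) (sumF-δ k f (lookup v i)))))
  (trans (sumF-comm n k _) (sumF-cong k (λ c → *-distribʳ-sumF n (f c) (λ i → ι (lookup v i Fin.≟ c)))))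
  where
  *-distribʳ-sumF : ∀ n a (g : Fin n → ℕ) → sumF n (λ i → g i * a) ≡ sumF n g * a
  *-distribʳ-sumF zero    a g = refl
  *-distribʳ-sumF (suc n) a g rewrite *-distribʳ-sumF n a (g ∘ suc) = sym (*-distribʳ-+ a (g zero) _)

occ-total : ∀ {n k} (v : Code n k) → sumF k (λ c → occ c v) ≡ n
occ-total {n} {k} v = trans (sumF-cong k (λ c → sym (*-identityʳ _)))
  (trans (sym (occ-∑ (λ _ → 1) v)) (trans (sumF-const n 1) (*-identityʳ n)))

occ-unique≤1 : ∀ {n k} (v : Code n k) → Unique v → ∀ c → occ c v ≤ 1
occ-unique≤1 {n} v u c with Fin.any? (λ i → lookup v i Fin.≟ c)
... | no ∄ = ≤-trans (≤-reflexive (trans (sumF-cong n (λ i → ι-no (lookup v i Fin.≟ c) (λ eq → ∄ (i , eq)))) (sumF-0 n))) z≤n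
... | yes (i , eq) = ≤-trans (sumF-mono n (λ j → ι-mono (lookup v j Fin.≟ c) (j Fin.≟ i)
        (λ eq′ → lookup-injective u j i (trans eq′ (sym eq))))) (≤-reflexive (sumF-δ1 n i))

-- No value occurs twice, and the occurrences of the `n` possible values add up to `n`, so none is
-- missing.
occ-permutation : ∀ {n} (σ : Code n n) → Unique σ → ∀ p → occ p σ ≡ 1
occ-permutation {n} σ u p with occ p σ in eq | occ-unique≤1 σ u p
... | suc zero | _ = refl
... | suc (suc _) | s≤s ()
... | zero | _ = contradiction
  (≤-trans (sumF-mono-< n (occ-unique≤1 σ u) p (≤-reflexive (cong suc eq))) (≤-reflexive (trans (sumF-const n 1) (*-identityʳ n))))
  (≤⇒≯ (≤-reflexive (sym (occ-total σ))))

occ-rearrange : ∀ {n k} (σ : Code n n) → Unique σ → (Q : Code n k) → ∀ c → occ c (rearrange σ Q) ≡ occ c Q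
occ-rearrange {n} σ u Q c = trans (sumF-cong n (λ i → cong (λ t → ι (t Fin.≟ c)) (lookup-map i (lookup Q) σ)))
  (trans (occ-∑ (λ p → ι (lookup Q p Fin.≟ c)) σ)
         (sumF-cong n (λ p → trans (cong (_* ι (lookup Q p Fin.≟ c)) (occ-permutation σ u p)) (*-identityˡ _))))

matches≤common : ∀ {n k} (Q h : Code n k) → matches Q h ≤ common Q h
matches≤common []      []      = z≤n
matches≤common {suc n} {k} (q ∷ Q) (x ∷ h) = begin
  ι (q Fin.≟ x) + matches Q h
    ≤⟨ +-mono-≤ (≤-reflexive (sym (sumF-δ k (λ _ → ι (q Fin.≟ x)) q))) (matches≤common Q h) ⟩
  sumF k (λ c → ι (c Fin.≟ q) * ι (q Fin.≟ x)) + common Q h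
    ≡⟨ sym (sumF-+ k _ _) ⟩
  sumF k (λ c → ι (c Fin.≟ q) * ι (q Fin.≟ x) + occ c Q ⊓ occ c h)
    ≤⟨ sumF-mono k termwise ⟩
  common (q ∷ Q) (x ∷ h) ∎
  where
  open ≤-Reasoning
  termwise : ∀ c → ι (c Fin.≟ q) * ι (q Fin.≟ x) + occ c Q ⊓ occ c h ≤ (ι (q Fin.≟ c) + occ c Q) ⊓ (ι (x Fin.≟ c) + occ c h)
  termwise c with c Fin.≟ q | q Fin.≟ x
  ... | no _ | _ = ⊓-mono-≤ (m≤n+m _ _) (m≤n+m _ _)
  ... | yes _ | no _ = ⊓-mono-≤ (m≤n+m _ _) (m≤n+m _ _)
  ... | yes refl | yes refl rewrite ι-yes (c Fin.≟ c) refl = ≤-refl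

sumL-↭ : ∀ {A : Set} (f : A → ℕ) {xs ys} → xs ↭ ys → sumL f xs ≡ sumL f ys
sumL-↭ f ↭.refl = refl
sumL-↭ f (prep x p) = cong (f x +_) (sumL-↭ f p)
sumL-↭ f (swap x y p) = trans (cong (λ t → f x + (f y + t)) (sumL-↭ f p)) (exchange (f x) (f y) _)
  where
  exchange : ∀ a b c → a + (b + c) ≡ b + (a + c)
  exchange = solve-∀
sumL-↭ f (↭.trans p q) = trans (sumL-↭ f p) (sumL-↭ f q)

∈⇒↭ : ∀ {A : Set} {x : A} {xs} → x ∈ xs → ∃[ ys ] xs ↭ x ∷ ys
∈⇒↭ m with ys , zs , refl ← ∈-∃++ m = ys ++ zs , shift _ ys zs

occ-toList : ∀ {m k} (c : Fin k) (v : Vec (Fin k) m) → count (Fin._≟ c) (toList v) ≡ occ c v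
occ-toList c []      = refl
occ-toList c (x ∷ v) = cong (ι (x Fin.≟ c) +_) (occ-toList c v)

occ≤1⇒Unique : ∀ {m k} (v : Vec (Fin k) m) → (∀ c → occ c v ≤ 1) → Unique v
occ≤1⇒Unique []      _  = []
occ≤1⇒Unique {suc m} (x ∷ v) le = VAll.lookup⁻ fresh ∷ occ≤1⇒Unique v (λ c → ≤-trans (m≤n+m _ _) (le c))
  where
  fresh : ∀ i → x ≢ lookup v i
  fresh i eq = contradiction (≤-trans (+-mono-≤ (≤-reflexive (sym (ι-yes (x Fin.≟ x) refl)))
      (≤-trans (≤-reflexive (sym (ι-yes (lookup v i Fin.≟ x) (sym eq)))) (f≤sumF m (λ i → ι (lookup v i Fin.≟ x)) i))) (le x)) (λ { (s≤s ()) })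

-- Positions of Q are assigned to the entries of h one by one, a position with
-- the right letter being preferred whenever one is left.
assign : ∀ {n k} (Q : Code n k) {m} (h : Vec (Fin k) m) (pool : List (Fin n)) → m ≤ length pool →
  ∃[ σ ] ∃[ rest ] ((toList σ ++ rest ↭ pool) ×
    sumF k (λ c → count (λ p → lookup Q p Fin.≟ c) pool ⊓ occ c h) ≤ matches (Vec.map (lookup Q) σ) h)
assign {k = k} Q [] pool _ = [] , pool , ↭-refl , ≤-reflexive (trans (sumF-cong k (λ c → ⊓-zeroʳ _)) (sumF-0 k))
assign {n} {k} Q {suc m} (x ∷ h) pool le with Any.any? (λ p → lookup Q p Fin.≟ x) pool
... | yes any with p , p∈ , Qp≡x ← find any with pool′ , perm ← ∈⇒↭ p∈
    with σ , rest , perm′ , bound ← assign Q h pool′ (s≤s⁻¹ (subst (suc m ≤_) (↭-length perm) le)) =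
  p ∷ σ , rest , ↭-trans (prep p perm′) (↭-sym perm) , (begin
    sumF k (λ c → count (λ p → lookup Q p Fin.≟ c) pool ⊓ (ι (x Fin.≟ c) + occ c h))
      ≡⟨ sumF-cong k termwise ⟩
    sumF k (λ c → ι (c Fin.≟ x) + count (λ p → lookup Q p Fin.≟ c) pool′ ⊓ occ c h)
      ≡⟨ sumF-+ k _ _ ⟩
    sumF k (λ c → ι (c Fin.≟ x)) + sumF k (λ c → count (λ p → lookup Q p Fin.≟ c) pool′ ⊓ occ c h)
      ≤⟨ +-mono-≤ (≤-reflexive (trans (sumF-δ1 k x) (sym (ι-yes (lookup Q p Fin.≟ x) Qp≡x)))) bound ⟩
    ι (lookup Q p Fin.≟ x) + matches (Vec.map (lookup Q) σ) h ∎)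
  where
  open ≤-Reasoning
  termwise : ∀ c → count (λ p → lookup Q p Fin.≟ c) pool ⊓ (ι (x Fin.≟ c) + occ c h)
           ≡ ι (c Fin.≟ x) + count (λ p → lookup Q p Fin.≟ c) pool′ ⊓ occ c h
  termwise c rewrite sumL-↭ (λ p → ι (lookup Q p Fin.≟ c)) perm | Qp≡x
                   | ι-cong (x Fin.≟ c) (c Fin.≟ x) sym sym = sym (+-distribˡ-⊓ (ι (c Fin.≟ x)) _ _)
-- No position in the pool carries `x`, so `x` contributes nothing to the left-hand side. It takes a
-- position that the later entries leave over, which exists because the pool is large enough.
... | no ∄ with assign Q h pool (≤-trans (n≤1+n m) le)
...   | σ , [] , perm , bound = contradiction le (<⇒≱ (s≤s (≤-reflexive (trans (sym (↭-length perm)) (len σ)))))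
  where
  len : ∀ {m} (v : Vec (Fin n) m) → length (toList v ++ []) ≡ m
  len []      = refl
  len (_ ∷ v) = cong suc (len v)
...   | σ , y ∷ rest , perm , bound = y ∷ σ , rest , ↭-trans (↭-sym (shift y (toList σ) rest)) perm ,
  ≤-trans (sumF-mono k termwise) (≤-trans bound (m≤n+m _ _))
  where
  none : ∀ {ps} → ¬ Any.Any (λ p → lookup Q p ≡ x) ps → count (λ p → lookup Q p Fin.≟ x) ps ≡ 0
  none {[]}     ∄ = refl
  none {p ∷ ps} ∄ rewrite ι-no (lookup Q p Fin.≟ x) (∄ ∘ here) = none (∄ ∘ there)
  termwise : ∀ c → count (λ p → lookup Q p Fin.≟ c) pool ⊓ (ι (x Fin.≟ c) + occ c h)
           ≤ count (λ p → lookup Q p Fin.≟ c) pool ⊓ occ c h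
  termwise c with x Fin.≟ c
  ... | yes refl rewrite none ∄ = z≤n
  ... | no _ = ≤-refl

common-witness : ∀ {n k} (Q h : Code n k) → ∃[ σ ] (Unique σ × common Q h ≤ matches (rearrange σ Q) h)
common-witness {n} {k} Q h with σ , rest , perm , bound ← assign Q h (allFin n) (≤-reflexive (sym (length-tabulate id))) =
  σ , occ≤1⇒Unique σ once ,
  ≤-trans (≤-reflexive (sumF-cong k (λ c → cong (_⊓ occ c h) (sym (sumL-tabulate _ n id))))) bound
  where
  open ≤-Reasoning
  once : ∀ p → occ p σ ≤ 1
  once p = begin
    occ p σ ≡⟨ sym (occ-toList p σ) ⟩
    count (Fin._≟ p) (toList σ) ≤⟨ m≤m+n _ _ ⟩
    count (Fin._≟ p) (toList σ) + count (Fin._≟ p) rest ≡⟨ sym (sumL-++ _ (toList σ) rest) ⟩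
    count (Fin._≟ p) (toList σ ++ rest) ≡⟨ sumL-↭ _ perm ⟩
    count (Fin._≟ p) (allFin n) ≡⟨ trans (sumL-tabulate _ n id) (sumF-δ1 n p) ⟩
    1 ∎

-- A rearrangement keeps the multiset of letters, which gives the upper bound; the greedy assignment
-- attains it.
total≡common : ∀ {n k} (Q h : Code n k) → total Q h ≡ common Q h
total≡common {n} {k} Q h = ≤-antisym (max≤v⁺ z≤n (All.map⁺ (All.tabulate upper))) lower
  where
  upper : ∀ {σ} → σ ∈ permutations n → blackPegs (rearrange σ Q) h ≤ common Q h
  upper {σ} m = ≤-trans (≤-reflexive (blackPegs≡matches (rearrange σ Q) h))
    (≤-trans (matches≤common (rearrange σ Q) h)
      (≤-reflexive (sumF-cong k (λ c → cong (_⊓ occ c h) (occ-rearrange σ (proj₂ (∈-filter⁻ unique? {xs = allCodes n n} m)) Q c)))))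
  lower : common Q h ≤ total Q h
  lower with σ , u , bound ← common-witness Q h =
    ≤-trans bound (≤-trans (≤-reflexive (sym (blackPegs≡matches (rearrange σ Q) h)))
      (v≤max⁺ 0 _ (inj₂ (Any.map ≤-reflexive (∈-map⁺ (λ σ → blackPegs (rearrange σ Q) h) (∈-filter⁺ unique? (allCodes-complete σ) u))))))

matches≤total : ∀ {n k} (Q h : Code n k) → matches Q h ≤ total Q h
matches≤total Q h = ≤-trans (matches≤common Q h) (≤-reflexive (sym (total≡common Q h)))

module _ {n k : ℕ} where

  Δ-matches : ∀ (Q h h′ : Code n k) → Δ blackWhite Q h ≡ Δ blackWhite Q h′ → matches Q h ≡ matches Q h′
  Δ-matches Q h h′ eq = trans (sym (blackPegs≡matches Q h)) (trans (cong proj₁ eq) (blackPegs≡matches Q h′))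

  black≤total : ∀ Q (h : Code n k) → blackPegs Q h ≤ total Q h
  black≤total Q h = subst (_≤ total Q h) (sym (blackPegs≡matches Q h)) (matches≤total Q h)

  -- Black pegs never exceed the total, so the truncated difference in `whitePegs` loses nothing and
  -- the two components of the response add up to the total.
  Δ-common : ∀ (Q h h′ : Code n k) → Δ blackWhite Q h ≡ Δ blackWhite Q h′ → common Q h ≡ common Q h′
  Δ-common Q h h′ eq = trans (sym (total≡common Q h)) (trans total-eq (total≡common Q h′))
    where
    total-eq : total Q h ≡ total Q h′
    total-eq = trans (sym (m+[n∸m]≡n (black≤total Q h)))
      (trans (cong₂ _+_ (cong proj₁ eq) (cong proj₂ eq)) (m+[n∸m]≡n (black≤total Q h′)))

  Δ-from : ∀ (Q h h′ : Code n k) → matches Q h ≡ matches Q h′ → common Q h ≡ common Q h′ →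
    Δ blackWhite Q h ≡ Δ blackWhite Q h′
  Δ-from Q h h′ b m = cong₂ _,_ b′ (cong₂ _∸_ (trans (total≡common Q h) (trans m (sym (total≡common Q h′)))) b′)
    where
    b′ : blackPegs Q h ≡ blackPegs Q h′
    b′ = trans (blackPegs≡matches Q h) (trans b (sym (blackPegs≡matches Q h′)))

-- Minimax runs

allCodes-unique : ∀ n k → List.Unique (allCodes n k)
allCodes-unique zero    k = [] ∷ []
allCodes-unique (suc n) k = Unique.cartesianProductWith⁺ _∷_ (λ { refl → refl , refl })
  (Unique.allFin⁺ k) (allCodes-unique n k)

filter-filter : ∀ {A : Set} {P Q R : A → Set} (P? : Decidable P) (Q? : Decidable Q) (R? : Decidable R) →
  (∀ {x} → R x → P x × Q x) → (∀ {x} → P x → Q x → R x) → ∀ xs → filter R? xs ≡ filter Q? (filter P? xs)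
filter-filter P? Q? R? to from [] = refl
filter-filter P? Q? R? to from (x ∷ xs) with ih ← filter-filter P? Q? R? to from xs with R? x | P? x
... | yes r | yes p = trans (cong (x ∷_) ih) (sym (filter-accept Q? (proj₂ (to r))))
... | yes r | no ¬p = contradiction (proj₁ (to r)) ¬p
... | no ¬r | yes p = trans ih (sym (filter-reject Q? (λ q → ¬r (from p q))))
... | no ¬r | no ¬p = ih

count-≡ : ∀ {n k} {S : List (Code n k)} → List.Unique S → {P : Code n k → Set} (P? : Decidable P) →
  ∀ {v} → (∀ {h} → P h → h ≡ v) → count P? S ≤ 1
count-≡ [] P? only = z≤n
count-≡ {S = x ∷ S} (x∉ ∷ u) P? only with P? x
... | no _  = count-≡ u P? only
... | yes p = s≤s (≤-reflexive (none S x∉))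
  where
  none : ∀ S → All (x ≢_) S → count P? S ≡ 0
  none [] [] = refl
  none (y ∷ S) (x≢y ∷ x∉) = cong₂ _+_ (ι-no (P? y) (λ q → x≢y (trans (only p) (sym (only q))))) (none S x∉)

matches-self : ∀ {n k} (Q : Code n k) → matches Q Q ≡ n
matches-self {n} Q = trans (sumF-cong n (λ i → ι-yes (lookup Q i Fin.≟ lookup Q i) refl)) (trans (sumF-const n 1) (*-identityʳ n))

matches-all : ∀ {n k} (Q h : Code n k) → matches Q h ≡ n → Q ≡ h
matches-all [] [] _ = refl
matches-all {suc n} (q ∷ Q) (x ∷ h) eq with q Fin.≟ x
... | yes refl = cong (q ∷_) (matches-all Q h (suc-injective eq))
... | no _ = contradiction (≤-trans (sumF-mono n (λ i → ι≤1 (lookup Q i Fin.≟ lookup h i)))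
                                   (≤-reflexive (trans (sumF-const n 1) (*-identityʳ n)))) (<⇒≱ (≤-reflexive (sym eq)))

Δ-black : ∀ φ {n k} (Q h h′ : Code n k) → Δ φ Q h ≡ Δ φ Q h′ → matches Q h ≡ matches Q h′
Δ-black black      Q h h′ eq = trans (sym (blackPegs≡matches Q h)) (trans eq (blackPegs≡matches Q h′))
Δ-black blackWhite Q h h′ eq = Δ-matches Q h h′ eq

module Minimax (φ : Feedback) (ρ : Repetitions) (n k : ℕ) where
  open Game φ ρ n k

  ∈𝒱⁺ : ∀ {v} → Valid ρ v → v ∈ 𝒱 ρ n k
  ∈𝒱⁺ {v} = ∈-filter⁺ (valid? ρ) (allCodes-complete v)

  ∈𝒱⁻ : ∀ {v} → v ∈ 𝒱 ρ n k → Valid ρ v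
  ∈𝒱⁻ m = proj₂ (∈-filter⁻ (valid? ρ) {xs = allCodes n k} m)

  class : List (Code n k) → Code n k → Response φ → List (Code n k)
  class S q r = filter (λ h → Δ φ q h ≟ᴿ r) S

  class≤score : ∀ S q {v} → Valid ρ v → length (class S q (Δ φ q v)) ≤ score S q
  class≤score S q ok = All.lookup (xs≤max 0 (map (λ r → length (class S q r)) (responses q)))
    (∈-map⁺ _ (∈-map⁺ (Δ φ q) (∈𝒱⁺ ok)))

  score-attained : ∀ S q {v} → Valid ρ v → ∃[ r ] score S q ≤ length (class S q r)
  score-attained S q {v} ok with argmax-sel id 0 (map (λ r → length (class S q r)) (responses q))
  -- The maximum is the default 0, so any class is large enough.
  ... | inj₁ eq = Δ φ q v , subst (_≤ _) (sym eq) z≤n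
  ... | inj₂ m with r , _ , eq ← ∈-map⁻ (λ r → length (class S q r)) m = r , ≤-reflexive eq

  -- A query taken from S itself is alone in its class, so it splits S.
  score<length : ∀ S → List.Unique S → 2 ≤ length S → ∀ {v} → v ∈ S → Valid ρ v → score S v < length S
  score<length S u 2≤ {v} v∈ ok = max<v⁺ {xs = map (λ r → length (class S v r)) (responses v)} (≤-trans (s≤s z≤n) 2≤) (All.map⁺ (All.tabulate (λ {r} _ → small r)))
    where
    small : ∀ r → length (class S v r) < length S
    small r with Δ φ v v ≟ᴿ r
    ... | yes refl = ≤-<-trans (≤-trans (≤-reflexive (count≡length-filter (λ h → Δ φ v h ≟ᴿ r) S))
            (count-≡ u (λ h → Δ φ v h ≟ᴿ r) (λ {h} eq → sym (matches-all v h (trans (Δ-black φ v h v eq) (matches-self v)))))) 2≤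
    ... | no neq = subst₂ _<_ (sym (count≡length-filter (λ h → Δ φ v h ≟ᴿ r) S)) (trans (sumL-const 1 S) (*-identityʳ _))
            (count-< (λ h → Δ φ v h ≟ᴿ r) (λ _ → yes tt) {v} S (λ _ _ → tt) v∈ neq tt)

  -- A turn at which the game is still open, reduced to the facts used about the remaining set;
  -- `next` is what remains after the response.
  record Step (S : List (Code n k)) (Q H : Code n k) : Set where
    field
      unique  : List.Unique S
      valid   : ∀ {h} → h ∈ S → Valid ρ h
      H∈S     : H ∈ S
      2≤      : 2 ≤ length S
      minimax : IsMinimaxGuess S Q

    next : List (Code n k)
    next = class S Q (Δ φ Q H)

    next≤score : length next ≤ score S Q
    next≤score = class≤score S Q (valid H∈S)

    score< : score S Q < length S
    score< = ≤-<-trans (proj₂ minimax H (valid H∈S)) (score<length S unique 2≤ H∈S (valid H∈S))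

    next< : length next < length S
    next< = ≤-<-trans next≤score score<

    next⊆ : next ⊆ S
    next⊆ m = proj₁ (∈-filter⁻ (λ h → Δ φ Q h ≟ᴿ Δ φ Q H) {xs = S} m)

    next-Δ : ∀ {h} → h ∈ next → Δ φ Q h ≡ Δ φ Q H
    next-Δ m = proj₂ (∈-filter⁻ (λ h → Δ φ Q h ≟ᴿ Δ φ Q H) {xs = S} m)

    score-≤ : ∀ Q′ → Valid ρ Q′ → ∃[ r ] score S Q ≤ length (class S Q′ r)
    score-≤ Q′ ok with r , le ← score-attained S Q′ (valid H∈S) = r , ≤-trans (proj₂ minimax Q′ ok) le

    leaves : ∃[ h ] (h ∈ S × Δ φ Q h ≢ Δ φ Q H)
    leaves = avoid (λ h → Δ φ Q h ≟ᴿ Δ φ Q H) S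
      (subst (_< length S) (count≡length-filter (λ h → Δ φ Q h ≟ᴿ Δ φ Q H) S) next<)

  module Run (H : Code n k) (validH : Valid ρ H) (Q : ℕ → Code n k) (run : IsMinimaxRun H Q) where

    remaining-suc : ∀ t → remaining H Q (suc t) ≡ class (remaining H Q t) (Q t) (Δ φ (Q t) H)
    remaining-suc t = filter-filter (consistent? H Q t) (λ h → Δ φ (Q t) h ≟ᴿ Δ φ (Q t) H) (consistent? H Q (suc t))
      (λ c → (λ i<t → c (m≤n⇒m≤1+n i<t)) , c ≤-refl)
      (λ {h} c eq {i} i<1+t → [ c , (λ { refl → eq }) ]′ (m≤n⇒m<n∨m≡n (s≤s⁻¹ i<1+t)))
      (𝒱 ρ n k)

    H∈remaining : ∀ t → H ∈ remaining H Q t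
    H∈remaining t = ∈-filter⁺ (consistent? H Q t) (∈𝒱⁺ validH) (λ _ → refl)

    step : ∀ t → ¬ Identified H Q t → Step (remaining H Q t) (Q t) H
    step t ¬id = record
      { unique  = Unique.filter⁺ (consistent? H Q t) (Unique.filter⁺ (valid? ρ) (allCodes-unique n k))
      ; valid   = λ m → ∈𝒱⁻ (proj₁ (∈-filter⁻ (consistent? H Q t) {xs = 𝒱 ρ n k} m))
      ; H∈S     = H∈remaining t
      ; 2≤      = ≤∧≢⇒< (nonempty (H∈remaining t)) (λ eq → ¬id (sym eq))
      ; minimax = run t ¬id
      }
      where
      nonempty : ∀ {S : List (Code n k)} → H ∈ S → 1 ≤ length S
      nonempty (here _)  = s≤s z≤n
      nonempty (there _) = s≤s z≤n

    -- The number `r` bounds the turns still to come: it drops in every turn, and so it cannot be 0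
    -- before `H` is identified.
    loop : (Potential : List (Code n k) → ℕ → Set) →
      (∀ {S Q H r} (s : Step S Q H) → Potential S r → ∃[ r′ ] (r ≡ suc r′ × Potential (Step.next s) r′)) →
      ∀ r t → Potential (remaining H Q t) r → ∃[ t′ ] (t′ ≤ t + r × Identified H Q t′)
    loop Ψ decrease r t pot with length (remaining H Q t) ≟ 1
    ... | yes id = t , m≤m+n t r , id
    ... | no ¬id with decrease (step t ¬id) pot
    ...   | r′ , refl , pot′ with t′ , le , id ← loop Ψ decrease r′ (suc t) (subst (λ S → Ψ S r′) (sym (remaining-suc t)) pot′)
          = t′ , ≤-trans le (≤-reflexive (sym (+-suc t r′))) , id

-- Affine responses

weight : ∀ {n k} → (Fin n → Fin k → ℕ) → Code n k → ℕ
weight {n} w h = sumF n (λ i → w i (lookup h i))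

eval-weight : ∀ {n k} (w : Fin n → Fin k → ℕ) (h : Code n k) → eval (λ i c → pos (w i c)) h ≡ pos (weight w h)
eval-weight w []      = refl
eval-weight w (c ∷ h) = cong (λ t → pos (w zero c) ℤ.+ t) (eval-weight (w ∘ suc) h)

weight-drop : ∀ {n k d} {S C : List (Code n k)} (w : Fin n → Fin k → ℕ) → RankLe S d → C ⊆ S →
  (∀ {h h′} → h ∈ C → h′ ∈ C → weight w h ≡ weight w h′) →
  ∀ {g g′} → g ∈ S → g′ ∈ S → weight w g ≢ weight w g′ →
  ∃[ d′ ] (d ≡ suc d′ × RankLe C d′)
weight-drop w rk C⊆S same {g} {g′} g∈ g′∈ neq = rank-drop (λ i c → pos (w i c)) rk C⊆S
  (λ {h} {h′} m m′ → trans (eval-weight w h) (trans (cong pos (same m m′)) (sym (eval-weight w h′)))) g∈ g′∈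
  (λ eq → neq (ℤ.+-injective (trans (sym (eval-weight w g)) (trans eq (eval-weight w g′)))))

matches-drop : ∀ {n k d} {S C : List (Code n k)} (Q : Code n k) → RankLe S d → C ⊆ S →
  (∀ {h h′} → h ∈ C → h′ ∈ C → matches Q h ≡ matches Q h′) →
  ∀ {g g′} → g ∈ S → g′ ∈ S → matches Q g ≢ matches Q g′ →
  ∃[ d′ ] (d ≡ suc d′ × RankLe C d′)
matches-drop Q = weight-drop (λ i c → ι (lookup Q i Fin.≟ c))

rearranged≤common : ∀ {n k} (σ : Code n n) → Unique σ → (Q h : Code n k) → matches (rearrange σ Q) h ≤ common Q h
rearranged≤common {k = k} σ u Q h = ≤-trans (matches≤common (rearrange σ Q) h)
  (≤-reflexive (sumF-cong k (λ c → cong (_⊓ occ c h) (occ-rearrange σ u Q c))))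

-- All occurrence numbers are at most 1, so each minimum is a product, and the sum of the products
-- is additive over the positions of `h`.
common-unique : ∀ {n k} (Q h : Code n k) → Unique Q → Unique h →
  common Q h ≡ weight (λ _ c → occ c Q) h
common-unique {n} {k} Q h uQ uh = trans (sumF-cong k (λ c → small (occ-unique≤1 Q uQ c) (occ-unique≤1 h uh c)))
  (sym (occ-∑ (λ c → occ c Q) h))
  where
  small : ∀ {a b} → a ≤ 1 → b ≤ 1 → a ⊓ b ≡ b * a
  small {zero}  {b} _ _ = sym (*-zeroʳ b)
  small {suc zero} {zero} _ _ = refl
  small {suc zero} {suc zero} _ _ = refl
  small {suc (suc _)} (s≤s ()) _
  small {suc zero} {suc (suc _)} _ (s≤s ())

-- For at most two positions the number of common letters is, depending on
-- whether there is a black peg, the number of matches of Q or of its reversal.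
short : ∀ {n k} → n ≤ 2 → (Q : Code n k) → ∃[ Q′ ] (∀ h →
  (matches Q h ≡ 0 → common Q h ≡ matches Q′ h) × (0 < matches Q h → common Q h ≡ matches Q h))
short {zero} {k} _ [] = [] , λ { [] → (λ _ → sumF-0 k) , λ () }
short {suc zero} _ (q ∷ []) = q ∷ [] , λ h → (λ _ → eq h) , λ _ → eq h
  where
  eq : ∀ h → common (q ∷ []) h ≡ matches (q ∷ []) h
  eq h with common-witness (q ∷ []) h
  ... | zero ∷ [] , _ , le = ≤-antisym le (matches≤common (q ∷ []) h)
short {suc (suc zero)} _ (a ∷ b ∷ []) = b ∷ a ∷ [] , λ h →
  (λ eq → ≤-antisym (≤-trans (upper h) (≤-reflexive (cong (_⊔ matches (b ∷ a ∷ []) h) eq))) (rearranged≤common (suc zero ∷ zero ∷ []) (((λ ()) ∷ []) ∷ [] ∷ []) (a ∷ b ∷ []) h)) ,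
  (λ lt → ≤-antisym (≤-trans (upper h) (⊔-lub ≤-refl (swapped h lt))) (matches≤common (a ∷ b ∷ []) h))
  where
  upper : ∀ h → common (a ∷ b ∷ []) h ≤ matches (a ∷ b ∷ []) h ⊔ matches (b ∷ a ∷ []) h
  upper h with common-witness (a ∷ b ∷ []) h
  ... | zero ∷ suc zero ∷ [] , _ , le = ≤-trans le (m≤m⊔n _ _)
  ... | suc zero ∷ zero ∷ [] , _ , le = ≤-trans le (m≤n⊔m (matches (a ∷ b ∷ []) h) _)
  ... | zero ∷ zero ∷ [] , (ne ∷ []) ∷ _ , _ = contradiction refl ne
  ... | suc zero ∷ suc zero ∷ [] , (ne ∷ []) ∷ _ , _ = contradiction refl ne
  swapped : ∀ h → 0 < matches (a ∷ b ∷ []) h → matches (b ∷ a ∷ []) h ≤ matches (a ∷ b ∷ []) h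
  swapped (x ∷ y ∷ []) lt with b Fin.≟ x | a Fin.≟ y
  ... | no _ | no _ = z≤n
  ... | no _ | yes _ = lt
  ... | yes _ | no _ = lt
  -- Here `h` is the reversal of the query, and a match between the two forces both letters to be
  -- equal.
  ... | yes refl | yes refl with a Fin.≟ b
  ...   | yes refl rewrite ι-yes (b Fin.≟ b) refl = ≤-refl
  ...   | no a≢b rewrite ι-no (b Fin.≟ a) (a≢b ∘ sym) with () ← lt
short {suc (suc (suc _))} (s≤s (s≤s ())) _

module _ {φ : Feedback} {ρ : Repetitions} {n k : ℕ} where
  open Minimax φ ρ n k

  -- Black pegs are an affine function in every variant, so only queries with constantly many black
  -- pegs on `S` are left to `otherwise`.
  linear-step : ∀ {S Q H d} (s : Step S Q H) → RankLe S d →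
    ((∀ {h} → h ∈ S → matches Q h ≡ matches Q H) → ∃[ d′ ] (d ≡ suc d′ × RankLe (Step.next s) d′)) →
    ∃[ d′ ] (d ≡ suc d′ × RankLe (Step.next s) d′)
  linear-step {S} {Q} {H} s rk otherwise with count-dec
    where
    count-dec : (∃[ h ] (h ∈ S × matches Q h ≢ matches Q H)) ⊎ (∀ {h} → h ∈ S → matches Q h ≡ matches Q H)
    count-dec with Any.any? (λ h → ¬? (matches Q h ≟ matches Q H)) S
    ... | yes any = inj₁ (find any)
    ... | no ∄ = inj₂ (λ {h} m → decidable-stable (matches Q h ≟ matches Q H) (λ ne → ∄ (lose m ne)))
  ... | inj₁ (h , m , ne) = matches-drop Q rk (Step.next⊆ s)
        (λ {h} {h′} m m′ → Δ-black φ Q h h′ (trans (Step.next-Δ s m) (sym (Step.next-Δ s m′)))) m (Step.H∈S s) ne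
  ... | inj₂ same = otherwise same

black-step : ∀ {ρ n k S Q H d} (s : Minimax.Step black ρ n k S Q H) → RankLe S d →
  ∃[ d′ ] (d ≡ suc d′ × RankLe (Minimax.Step.next s) d′)
black-step {Q = Q} {H} s rk = linear-step s rk (λ same →
  let h , m , ne = Minimax.Step.leaves s in
  contradiction (trans (blackPegs≡matches Q h) (trans (same m) (sym (blackPegs≡matches Q H)))) ne)

-- If the black pegs are constant on `S`, the totals are not, and the total is affine by
-- `common-unique`.
notAllowed-step : ∀ {n k S Q H d} (s : Minimax.Step blackWhite notAllowed n k S Q H) → RankLe S d →
  ∃[ d′ ] (d ≡ suc d′ × RankLe (Minimax.Step.next s) d′)
notAllowed-step {n} {k} {S} {Q} {H} s rk = linear-step s rk (λ same →
  let h , m , ne = leaves in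
  weight-drop (λ _ c → occ c Q) rk next⊆
    (λ {h} {h′} m m′ → trans (sym (linear (next⊆ m))) (trans (Δ-common Q h h′ (trans (next-Δ m) (sym (next-Δ m′)))) (linear (next⊆ m′))))
    m H∈S (λ eq → ne (Δ-from Q h H (same m) (trans (linear m) (trans eq (sym (linear H∈S)))))))
  where
  open Minimax.Step s
  linear : ∀ {h} → h ∈ S → common Q h ≡ weight (λ _ c → occ c Q) h
  linear {h} m = common-unique Q h (proj₁ minimax) (valid m)

short-step : ∀ {ρ n k} → n ≤ 2 → ∀ {S Q H d} (s : Minimax.Step blackWhite ρ n k S Q H) → RankLe S d →
  ∃[ d′ ] (d ≡ suc d′ × RankLe (Minimax.Step.next s) d′)
short-step n≤2 {S} {Q} {H} {d} s rk = linear-step s rk split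
  where
  open Minimax.Step s
  Q′ : Code _ _
  Q′ = proj₁ (short n≤2 Q)
  split : (∀ {h} → h ∈ S → matches Q h ≡ matches Q H) → ∃[ d′ ] (d ≡ suc d′ × RankLe next d′)
  split same with h , m , ne ← leaves with 0 <? matches Q H
  -- A positive constant number of black pegs determines the total, so `Q` would not split `S`.
  -- Without black pegs the total is the number of matches with `Q′`.
  ... | yes 0<β = contradiction (Δ-from Q h H (same m)
        (trans (proj₂ (proj₂ (short n≤2 Q) h) (subst (0 <_) (sym (same m)) 0<β))
          (trans (same m) (sym (proj₂ (proj₂ (short n≤2 Q) H) 0<β))))) ne
  ... | no ¬0<β = matches-drop Q′ rk next⊆
        (λ {h} {h′} m m′ → trans (sym (value (next⊆ m))) (trans (Δ-common Q h h′ (trans (next-Δ m) (sym (next-Δ m′)))) (value (next⊆ m′))))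
        m H∈S (λ eq → ne (Δ-from Q h H (same m) (trans (value m) (trans eq (sym (value H∈S))))))
    where
    value : ∀ {h} → h ∈ S → common Q h ≡ matches Q′ h
    value {h} m = proj₁ (proj₂ (short n≤2 Q) h) (trans (same m) (n≤0⇒n≡0 (≮⇒≥ ¬0<β)))

-- Responses kept by more than half of a set

common-rearrange : ∀ {n k} (σ : Code n n) → Unique σ → (Q h : Code n k) → common (rearrange σ Q) h ≡ common Q h
common-rearrange {k = k} σ u Q h = sumF-cong k (λ c → cong (_⊓ occ c h) (occ-rearrange σ u Q c))

-- Both sets contain more than half of `S`, so they meet. By `meet` the second then lies inside the
-- first, and not being smaller it is equal to it.
large-coincide : {A : Set} {P R : A → Set} (P? : Decidable P) (R? : Decidable R) (S : List A) →
  length S < count P? S + count P? S → count P? S ≤ count R? S →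
  (∀ {h*} → h* ∈ S → P h* → R h* → ∀ {h} → h ∈ S → R h → P h) →
  ∀ {h} → h ∈ S → P h → R h
large-coincide {P = P} {R} P? R? S large le meet {h} m p = decidable-stable (R? h) (λ ¬r → <⇒≱ (count-< R? P? S inside m ¬r p) le)
  where
  few : count (¬? ∘ P?) S + count (¬? ∘ R?) S < length S
  few = +-cancelˡ-< (count P? S + count R? S) _ _ (begin-strict
    (count P? S + count R? S) + (count (¬? ∘ P?) S + count (¬? ∘ R?) S)
      ≡⟨ rearrange-+ (count P? S) (count R? S) _ _ ⟩
    (count P? S + count (¬? ∘ P?) S) + (count R? S + count (¬? ∘ R?) S)
      ≡⟨ cong₂ _+_ (count-¬ P? S) (count-¬ R? S) ⟩
    length S + length S
      <⟨ +-monoˡ-< (length S) (<-≤-trans large (+-monoʳ-≤ (count P? S) le)) ⟩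
    (count P? S + count R? S) + length S ∎)
    where open ≤-Reasoning
  inside : ∀ {h} → h ∈ S → R h → P h
  inside with h* , m* , nn , nn′ ← avoid₂ (¬? ∘ P?) (¬? ∘ R?) S few =
    meet m* (decidable-stable (P? h*) nn) (decidable-stable (R? h*) nn′)

module _ {n k : ℕ} where
  open Minimax blackWhite allowed n k
  open Game blackWhite allowed n k

  -- If Q has constantly many black pegs on S, a rearrangement Q^σ that attains the larger of
  -- two values of the total does not.  Its largest class is at least as large as that of Q by
  -- minimality, hence meets it, hence is contained in it, hence is equal to it.
  majority-drop : ∀ {S Q H d} (s : Step S Q H) → length S < length (Step.next s) + length (Step.next s) →
    RankLe S d → ∃[ d′ ] (d ≡ suc d′ × RankLe (Step.next s) d′)
  majority-drop {S} {Q} {H} {d} s large rk = linear-step s rk split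
    where
    open Step s
    module _ (same : ∀ {h} → h ∈ S → matches Q h ≡ matches Q H) where
      nonconstant : ∀ {g g′} → g ∈ S → g′ ∈ S → common Q g < common Q g′ → ∃[ d′ ] (d ≡ suc d′ × RankLe next d′)
      nonconstant {g} {g′} g∈ g′∈ lt with σ , u , attained ← common-witness Q g′
                                     with r , big ← score-≤ (rearrange σ Q) tt =
        matches-drop Qσ rk next⊆ (λ {h} {h′} m m′ → Δ-matches Qσ h h′ (trans (in-class (next⊆ m) (next-Δ m)) (sym (in-class (next⊆ m′) (next-Δ m′)))))
          g∈ g′∈ (<⇒≢ (≤-<-trans (rearranged≤common σ u Q g) (<-≤-trans lt attained)))
        where
        Qσ : Code n k
        Qσ = rearrange σ Q
        In : ∀ h → Dec (Δ blackWhite Q h ≡ Δ blackWhite Q H)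
        In h = Δ blackWhite Q h ≟ᴿ Δ blackWhite Q H
        Inσ : ∀ h → Dec (Δ blackWhite Qσ h ≡ r)
        Inσ h = Δ blackWhite Qσ h ≟ᴿ r
        #In : length next ≡ count In S
        #In = count≡length-filter In S
        -- A common element fixes the total of the whole class of `Qσ`. Totals do not change under
        -- rearrangement and the black pegs of `Q` are constant, so the response to `Q` is fixed as
        -- well.
        inside : ∀ {h*} → h* ∈ S → Δ blackWhite Q h* ≡ Δ blackWhite Q H → Δ blackWhite Qσ h* ≡ r →
          ∀ {h} → h ∈ S → Δ blackWhite Qσ h ≡ r → Δ blackWhite Q h ≡ Δ blackWhite Q H
        inside {h*} m* p q {h} m eq = Δ-from Q h H (same m) (begin
            common Q h   ≡⟨ sym (common-rearrange σ u Q h) ⟩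
            common Qσ h  ≡⟨ Δ-common Qσ h h* (trans eq (sym q)) ⟩
            common Qσ h* ≡⟨ common-rearrange σ u Q h* ⟩
            common Q h*  ≡⟨ Δ-common Q h* H p ⟩
            common Q H   ∎)
          where open ≡-Reasoning
        in-class : ∀ {h} → h ∈ S → Δ blackWhite Q h ≡ Δ blackWhite Q H → Δ blackWhite Qσ h ≡ r
        in-class = large-coincide In Inσ S (subst (λ t → length S < t + t) #In large)
          (subst₂ _≤_ #In (count≡length-filter Inσ S) (≤-trans next≤score big)) inside

      split : ∃[ d′ ] (d ≡ suc d′ × RankLe next d′)
      split with h , m , ne ← leaves with <-cmp (common Q h) (common Q H)
      ... | tri< lt _ _ = nonconstant m H∈S lt
      ... | tri≈ _ eq _ = contradiction (Δ-from Q h H (same m) eq) ne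
      ... | tri> _ _ gt = nonconstant H∈S m gt

-- Coin flips

-- A coin decides at every position between two letters; equal letters mean
-- that the letter is fixed.
Coins : ℕ → ℕ → Set
Coins n k = Vec (Fin k × Fin k) n

outcomes : ∀ {n k} → Coins n k → List (Code n k)
outcomes []             = [] ∷ []
outcomes ((x , y) ∷ cs) = map (x ∷_) (outcomes cs) ++ map (y ∷_) (outcomes cs)

fixed : ∀ {n k} → Coins n k → ℕ
fixed {n} cs = sumF n (λ i → ι (proj₁ (lookup cs i) Fin.≟ proj₂ (lookup cs i)))

UnaffectedAt : ∀ {k} → Fin k × Fin k → Fin k → Set
UnaffectedAt (x , y) c = (x ≡ y × c ≡ x) ⊎ (x ≢ y × c ≢ x × c ≢ y)

-- The number of matches with h does not depend on the outcome, and all fixed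
-- letters match.
Unaffected : ∀ {n k} → Coins n k → Code n k → Set
Unaffected cs h = ∀ i → UnaffectedAt (lookup cs i) (lookup h i)

unaffectedAt? : ∀ {k} (p : Fin k × Fin k) c → Dec (UnaffectedAt p c)
unaffectedAt? (x , y) c = ((x Fin.≟ y) ×-dec (c Fin.≟ x)) ⊎-dec (¬? (x Fin.≟ y) ×-dec (¬? (c Fin.≟ x) ×-dec ¬? (c Fin.≟ y)))

unaffected? : ∀ {n k} (cs : Coins n k) h → Dec (Unaffected cs h)
unaffected? cs h = Fin.all? (λ i → unaffectedAt? (lookup cs i) (lookup h i))

first-outcome : ∀ {n k} (cs : Coins n k) → Vec.map proj₁ cs ∈ outcomes cs
first-outcome []             = here refl
first-outcome ((x , y) ∷ cs) = ∈-++⁺ˡ (∈-map⁺ (x ∷_) (first-outcome cs))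

length-outcomes : ∀ {n k} (cs : Coins n k) → length (outcomes cs) ≡ 2 ^ n
length-outcomes [] = refl
length-outcomes ((x , y) ∷ cs) = trans (length-++ (map (x ∷_) (outcomes cs)))
  (cong₂ _+_ (trans (length-map (x ∷_) (outcomes cs)) (length-outcomes cs))
             (trans (trans (length-map (y ∷_) (outcomes cs)) (length-outcomes cs)) (sym (+-identityʳ _))))

outcome-letter : ∀ {n k} (cs : Coins n k) {Q} → Q ∈ outcomes cs → ∀ i →
  lookup Q i ≡ proj₁ (lookup cs i) ⊎ lookup Q i ≡ proj₂ (lookup cs i)
outcome-letter ((x , y) ∷ cs) m i with ∈-++⁻ (map (x ∷_) (outcomes cs)) m
outcome-letter ((x , y) ∷ cs) m i | inj₁ m′ with ∈-map⁻ (x ∷_) m′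
outcome-letter ((x , y) ∷ cs) m zero    | inj₁ m′ | Q , m″ , refl = inj₁ refl
outcome-letter ((x , y) ∷ cs) m (suc i) | inj₁ m′ | Q , m″ , refl = outcome-letter cs m″ i
outcome-letter ((x , y) ∷ cs) m i | inj₂ m′ with ∈-map⁻ (y ∷_) m′
outcome-letter ((x , y) ∷ cs) m zero    | inj₂ m′ | Q , m″ , refl = inj₂ refl
outcome-letter ((x , y) ∷ cs) m (suc i) | inj₂ m′ | Q , m″ , refl = outcome-letter cs m″ i

unaffected-matches : ∀ {n k} (cs : Coins n k) {h} → Unaffected cs h → ∀ {Q} → Q ∈ outcomes cs → matches Q h ≡ fixed cs
unaffected-matches {n} cs {h} ua {Q} m = sumF-cong n (λ i → letter i (ua i) (outcome-letter cs m i))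
  where
  letter : ∀ i → UnaffectedAt (lookup cs i) (lookup h i) →
    lookup Q i ≡ proj₁ (lookup cs i) ⊎ lookup Q i ≡ proj₂ (lookup cs i) →
    ι (lookup Q i Fin.≟ lookup h i) ≡ ι (proj₁ (lookup cs i) Fin.≟ proj₂ (lookup cs i))
  letter i (inj₁ (x≡y , c≡x)) q = trans (ι-yes (lookup Q i Fin.≟ lookup h i) ([ (λ e → trans e (sym c≡x)) , (λ e → trans e (trans (sym x≡y) (sym c≡x))) ]′ q))
    (sym (ι-yes (proj₁ (lookup cs i) Fin.≟ proj₂ (lookup cs i)) x≡y))
  letter i (inj₂ (x≢y , c≢x , c≢y)) q = trans (ι-no (lookup Q i Fin.≟ lookup h i) (λ e → [ (λ e′ → c≢x (trans (sym e) e′)) , (λ e′ → c≢y (trans (sym e) e′)) ]′ q))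
    (sym (ι-no (proj₁ (lookup cs i) Fin.≟ proj₂ (lookup cs i)) x≢y))

#matching : ∀ {n k} → Coins n k → Code n k → ℕ → ℕ
#matching cs h v = count (λ Q → matches Q h ≟ v) (outcomes cs)

count-false : ∀ {A : Set} {P : A → Set} (P? : ∀ x → Dec (P x)) xs → (∀ {x} → x ∈ xs → ¬ P x) → count P? xs ≡ 0
count-false P? [] none = refl
count-false P? (x ∷ xs) none = cong₂ _+_ (ι-no (P? x) (none (here refl))) (count-false P? xs (none ∘ there))

module _ {n k : ℕ} (cs : Coins n k) (h : Code n k) where

  shifted : ℕ → ℕ → ℕ
  shifted a v = count (λ Q → a + matches Q h ≟ v) (outcomes cs)

  #matching-∷ : ∀ x y c v → #matching ((x , y) ∷ cs) (c ∷ h) v ≡ shifted (ι (x Fin.≟ c)) v + shifted (ι (y Fin.≟ c)) v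
  #matching-∷ x y c v = trans (sumL-++ _ (map (x ∷_) (outcomes cs)) _)
    (cong₂ _+_ (sumL-map _ (x ∷_) (outcomes cs)) (sumL-map _ (y ∷_) (outcomes cs)))

  -- A number and its successor cannot both equal `v`, so each outcome counts at most once.
  shifted-1-0 : ∀ v → shifted 1 v + shifted 0 v ≤ 2 ^ n
  shifted-1-0 v = subst (shifted 1 v + shifted 0 v ≤_) (trans (sumL-const 1 (outcomes cs)) (trans (*-identityʳ _) (length-outcomes cs)))
    (≤-trans (≤-reflexive (sym (sumL-+ _ _ (outcomes cs)))) (sumL-mono (outcomes cs) (λ {Q} _ → once (matches Q h))))
    where
    once : ∀ m → ι (suc m ≟ v) + ι (m ≟ v) ≤ 1
    once m = go (m ≟ v)
      where
      go : Dec (m ≡ v) → ι (suc m ≟ v) + ι (m ≟ v) ≤ 1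
      go (yes eq) = +-mono-≤ (≤-reflexive (ι-no (suc m ≟ v) (λ eq′ → 1+n≢n (trans eq′ (sym eq))))) (ι≤1 (m ≟ v))
      go (no ne)  = ≤-trans (+-mono-≤ (ι≤1 (suc m ≟ v)) (≤-reflexive (ι-no (m ≟ v) ne))) ≤-refl

  shifted-1-suc : ∀ v → shifted 1 (suc v) ≡ #matching cs h v
  shifted-1-suc v = sumL-cong (outcomes cs) (λ {Q} _ → ι-cong (suc (matches Q h) ≟ suc v) (matches Q h ≟ v) suc-injective (cong suc))

-- Flipping the first coin that involves the letter of h changes the number of matches by one.
affected-half : ∀ {n k} (cs : Coins n k) (h : Code n k) v → fixed cs ≤ v → ¬ Unaffected cs h →
  #matching cs h v + #matching cs h v ≤ 2 ^ n
affected-half [] [] v _ ¬ua = contradiction (λ ()) ¬ua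
affected-half {suc n} ((x , y) ∷ cs) (c ∷ h) v le ¬ua
  rewrite #matching-∷ cs h x y c v with x Fin.≟ y | x Fin.≟ c | y Fin.≟ c
... | yes refl | yes refl | no y≢c = contradiction refl y≢c
... | yes refl | no x≢c | yes refl = contradiction refl x≢c
... | no x≢y | yes refl | yes refl = contradiction refl x≢y
affected-half {suc n} ((x , y) ∷ cs) (c ∷ h) (suc v) le ¬ua | yes refl | yes refl | yes refl
  rewrite shifted-1-suc cs h v = ≤-trans (+-mono-≤ ih ih) (≤-reflexive (cong (2 ^ n +_) (sym (+-identityʳ (2 ^ n)))))
  where
  ih = affected-half cs h v (s≤s⁻¹ le) (λ ua → ¬ua (λ { zero → inj₁ (refl , refl) ; (suc i) → ua i }))
affected-half {suc n} ((x , y) ∷ cs) (c ∷ h) v le ¬ua | yes refl | no x≢c | no _ = double (unaffected? cs h)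
  where
  double : Dec (Unaffected cs h) → (#matching cs h v + #matching cs h v) + (#matching cs h v + #matching cs h v) ≤ 2 ^ suc n
  -- An unaffected rest always gives `fixed cs` matches. This is less than `v`, because the fixed
  -- letter that `h` misses is counted in `le`; hence no outcome counts.
  double (yes ua) rewrite count-false (λ Q → matches Q h ≟ v) (outcomes cs)
    (λ m eq → <⇒≱ (≤-reflexive (cong suc (trans (sym eq) (unaffected-matches cs {h} ua m)))) le) = z≤n
  double (no ¬ua′) = ≤-trans (+-mono-≤ ih ih) (≤-reflexive (cong (2 ^ n +_) (sym (+-identityʳ (2 ^ n)))))
    where ih = affected-half cs h v (≤-trans (n≤1+n _) le) ¬ua′
affected-half {suc n} ((x , y) ∷ cs) (c ∷ h) v le ¬ua | no x≢y | yes refl | no y≢c =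
  ≤-trans (+-mono-≤ (shifted-1-0 cs h v) (shifted-1-0 cs h v)) (≤-reflexive (cong (2 ^ n +_) (sym (+-identityʳ (2 ^ n)))))
affected-half {suc n} ((x , y) ∷ cs) (c ∷ h) v le ¬ua | no x≢y | no x≢c | yes refl =
  ≤-trans (+-mono-≤ bound bound) (≤-reflexive (cong (2 ^ n +_) (sym (+-identityʳ (2 ^ n)))))
  where
  bound : shifted cs h 0 v + shifted cs h 1 v ≤ 2 ^ n
  bound = ≤-trans (≤-reflexive (+-comm (shifted cs h 0 v) _)) (shifted-1-0 cs h v)
affected-half {suc n} ((x , y) ∷ cs) (c ∷ h) v le ¬ua | no x≢y | no x≢c | no y≢c =
  ≤-trans (+-mono-≤ ih ih) (≤-reflexive (cong (2 ^ n +_) (sym (+-identityʳ (2 ^ n)))))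
  where
  ih = affected-half cs h v le (λ ua → ¬ua (λ { zero → inj₂ (x≢y , x≢c ∘ sym , y≢c ∘ sym) ; (suc i) → ua i }))

-- Sets on which all responses are concentrated

weight-update : ∀ {n k} (w : Fin n → Fin k → ℕ) (Q : Code n k) i c →
  weight w (Q [ i ]≔ c) + w i (lookup Q i) ≡ weight w Q + w i c
weight-update w (q ∷ Q) zero c = swap-ends (w zero c) (weight (w ∘ suc) Q) (w zero q)
  where
  swap-ends : ∀ a b c → (a + b) + c ≡ (c + b) + a
  swap-ends = solve-∀
weight-update w (q ∷ Q) (suc i) c = trans (+-assoc (w zero q) _ _)
  (trans (cong (w zero q +_) (weight-update (w ∘ suc) Q i c)) (sym (+-assoc (w zero q) _ _)))

-- Discrete integration: `f` and `N` change equally under single-letter changes, so their difference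
-- is constant. It is written additively to avoid subtraction.
same-changes : ∀ {n k} (f N : Code n k → ℕ) →
  (∀ Q i c → f (Q [ i ]≔ c) + N Q ≡ f Q + N (Q [ i ]≔ c)) →
  ∀ Q Q′ → f Q′ + N Q ≡ f Q + N Q′
same-changes f N step [] [] = refl
same-changes f N step (q ∷ Q) (q′ ∷ Q′) = +-cancelʳ-≡ (N (q′ ∷ Q)) _ _ (begin
  (f (q′ ∷ Q′) + N (q ∷ Q)) + N (q′ ∷ Q)  ≡⟨ swap₂₃ (f (q′ ∷ Q′)) _ _ ⟩
  (f (q′ ∷ Q′) + N (q′ ∷ Q)) + N (q ∷ Q)  ≡⟨ cong (_+ N (q ∷ Q)) (same-changes (f ∘ (q′ ∷_)) (N ∘ (q′ ∷_)) (λ Q i c → step (q′ ∷ Q) (suc i) c) Q Q′) ⟩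
  (f (q′ ∷ Q) + N (q′ ∷ Q′)) + N (q ∷ Q)  ≡⟨ swap₂₃ (f (q′ ∷ Q)) _ _ ⟩
  (f (q′ ∷ Q) + N (q ∷ Q)) + N (q′ ∷ Q′)  ≡⟨ cong (_+ N (q′ ∷ Q′)) (step (q ∷ Q) zero q′) ⟩
  (f (q ∷ Q) + N (q′ ∷ Q)) + N (q′ ∷ Q′)  ≡⟨ swap₂₃ (f (q ∷ Q)) _ _ ⟩
  (f (q ∷ Q) + N (q′ ∷ Q′)) + N (q′ ∷ Q)  ∎)
  where
  open ≡-Reasoning
  swap₂₃ : ∀ a b c → (a + b) + c ≡ (a + c) + b
  swap₂₃ = solve-∀

-- If the letter at position i₀ is c, in excess of w c other occurrences, then Q notices it.
Tests : ∀ {n k} → (Fin k → ℕ) → Fin n → Code n k → Fin k → Set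
Tests w i₀ Q c = w c < occ c Q ⊎ lookup Q i₀ ≡ c

Exceptional : ∀ {n k} (β μ : Code n k → ℕ) → Code n k → Code n k → Set
Exceptional β μ Q h = ¬ (matches Q h ≡ β Q × common Q h ≡ μ Q)

exceptional? : ∀ {n k} (β μ : Code n k → ℕ) Q h → Dec (Exceptional β μ Q h)
exceptional? β μ Q h = ¬? ((matches Q h ≟ β Q) ×-dec (common Q h ≟ μ Q))

-- β and μ give the numbers of black and of all pegs received from more than three quarters of S.
module Concentrated {n k : ℕ} (x₀ x₁ : Fin k) (x₀≢x₁ : x₀ ≢ x₁)
  (S : List (Code n k)) (unique : List.Unique S) (2≤ : 2 ≤ length S)
  (g : ℕ) (β μ : Code n k → ℕ) (quiet : 4 * g < length S)
  (few : ∀ Q → count (exceptional? β μ Q) S ≤ g) where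

  typical : ∀ Q h → ¬ Exceptional β μ Q h → matches Q h ≡ β Q × common Q h ≡ μ Q
  typical Q h = decidable-stable ((matches Q h ≟ β Q) ×-dec (common Q h ≟ μ Q))

  4g : g + g + (g + g) < length S
  4g = subst (_< length S) (four g) quiet
    where
    four : ∀ g → 4 * g ≡ g + g + (g + g)
    four = solve-∀

  -- If `P` fails for at most `g + g` codes, then for less than half of `S`, as `4 * g` is less than
  -- its size.
  frequent : {P : Code n k → Set} (P? : ∀ h → Dec (P h)) → count (¬? ∘ P?) S ≤ g + g →
    length S < count P? S + count P? S
  frequent P? le = +-cancelʳ-< (length S) _ _ (begin-strict
    length S + length S ≡⟨ sym (cong₂ _+_ (count-¬ P? S) (count-¬ P? S)) ⟩
    (count P? S + count (¬? ∘ P?) S) + (count P? S + count (¬? ∘ P?) S) ≡⟨ rearrange-+ (count P? S) _ _ _ ⟩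
    (count P? S + count P? S) + (count (¬? ∘ P?) S + count (¬? ∘ P?) S) ≤⟨ +-monoʳ-≤ (count P? S + count P? S) (+-mono-≤ le le) ⟩
    (count P? S + count P? S) + (g + g + (g + g)) <⟨ +-monoʳ-< (count P? S + count P? S) 4g ⟩
    (count P? S + count P? S) + length S ∎)
    where open ≤-Reasoning

  has? : ∀ i c (h : Code n k) → Dec (lookup h i ≡ c)
  has? i c h = lookup h i Fin.≟ c

  Dominant : Fin n → Fin k → Set
  Dominant i c = length S < count (has? i c) S + count (has? i c) S

  dominant? : ∀ i → Dec (∃[ c ] Dominant i c)
  dominant? i = Fin.any? (λ c → length S <? count (has? i c) S + count (has? i c) S)

  majority : Fin n → Maybe (Fin k)
  majority i with dominant? i
  ... | yes (c , _) = just c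
  ... | no _        = nothing

  majority-just : ∀ {i c} → majority i ≡ just c → Dominant i c
  majority-just {i} eq with dominant? i
  majority-just refl | yes (_ , dom) = dom

  majority-nothing : ∀ {i} → majority i ≡ nothing → ∀ c → ¬ Dominant i c
  majority-nothing {i} eq c dom with dominant? i
  ... | no ∄ = ∄ (c , dom)

  -- The two characteristic properties of `majority` suffice from here on; as a variable `τ` does
  -- not unfold in case distinctions.
  module Template (τ : Fin n → Maybe (Fin k)) (τ-just : ∀ {i c} → τ i ≡ just c → Dominant i c)
    (τ-nothing : ∀ {i} → τ i ≡ nothing → ∀ c → ¬ Dominant i c) where

    is? : ∀ i c → Dec (τ i ≡ just c)
    is? i c = Maybe.≡-dec Fin._≟_ (τ i) (just c)

    hit : Fin n → Fin k → ℕ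
    hit i c = ι (is? i c)

    hit-just : ∀ {i t} → τ i ≡ just t → ∀ c {d} → d ≡ t → hit i c ≡ ι (c Fin.≟ d)
    hit-just {i} eq c {d} d≡t = ι-cong (is? i c) (c Fin.≟ d)
      (λ eq′ → trans (Maybe.just-injective (trans (sym eq′) eq)) (sym d≡t)) (λ c≡d → trans eq (cong just (sym (trans c≡d d≡t))))

    hit-nothing : ∀ {i} → τ i ≡ nothing → ∀ c → hit i c ≡ 0
    hit-nothing {i} eq c = ι-no (is? i c) (λ eq′ → case-absurd (trans (sym eq) eq′))
      where
      case-absurd : ∀ {c : Fin k} → nothing ≢ just c
      case-absurd ()

    -- At a position with majority letter, some code carries that letter and responds typically to
    -- both queries, so `β` changes as its matches do. Elsewhere a change of `β` would force the old
    -- or the new letter on all codes typical for both queries, making it a majority letter.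
    β-change : ∀ Q i c → β (Q [ i ]≔ c) + hit i (lookup Q i) ≡ β Q + hit i c
    β-change Q i c = go (τ i) refl
      where
      Q′ : Code n k
      Q′ = Q [ i ]≔ c
      change : ∀ h → matches Q′ h + ι (lookup Q i Fin.≟ lookup h i) ≡ matches Q h + ι (c Fin.≟ lookup h i)
      change h = weight-update (λ i c → ι (c Fin.≟ lookup h i)) Q i c
      few₂ : ∀ {P : Code n k → Set} (P? : ∀ h → Dec (P h)) →
        (∀ {h} → matches Q h ≡ β Q → matches Q′ h ≡ β Q′ → P h) → count (¬? ∘ P?) S ≤ g + g
      few₂ P? imp = ≤-trans (count-∪ (¬? ∘ P?) (exceptional? β μ Q) (exceptional? β μ Q′) S (λ {h} _ ¬p → cases h ¬p))
        (+-mono-≤ (few Q) (few Q′))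
        where
        cases : ∀ h → ¬ _ → Exceptional β μ Q h ⊎ Exceptional β μ Q′ h
        cases h ¬p with exceptional? β μ Q h | exceptional? β μ Q′ h
        ... | yes e | _ = inj₁ e
        ... | no _ | yes e = inj₂ e
        ... | no ne | no ne′ = contradiction (imp (proj₁ (typical Q h ne)) (proj₁ (typical Q′ h ne′))) ¬p
      enough : ∀ t → τ i ≡ just t → count (¬? ∘ has? i t) S + (count (exceptional? β μ Q) S + count (exceptional? β μ Q′) S) < length S
      enough t eq = subst (count (¬? ∘ has? i t) S + (count (exceptional? β μ Q) S + count (exceptional? β μ Q′) S) <_) (trans (+-comm (count (¬? ∘ has? i t) S) _) (count-¬ (has? i t) S))
        (+-monoʳ-< (count (¬? ∘ has? i t) S) (≤-<-trans (+-mono-≤ (few Q) (few Q′)) 2g<))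
        where
        2g< : g + g < count (has? i t) S
        2g< = ≰⇒> (λ le → <⇒≱ (<-trans 4g (τ-just eq)) (+-mono-≤ le le))
      go : ∀ t → τ i ≡ t → β Q′ + hit i (lookup Q i) ≡ β Q + hit i c
      go (just t) eq with h , m , ¬has , e , e′ ← avoid₃ (¬? ∘ has? i t) (exceptional? β μ Q) (exceptional? β μ Q′) S (enough t eq) =
        trans (cong₂ _+_ (sym (proj₁ (typical Q′ h e′))) (hit-just eq (lookup Q i) (decidable-stable (has? i t h) ¬has)))
          (trans (change h) (sym (cong₂ _+_ (sym (proj₁ (typical Q h e))) (hit-just eq c (decidable-stable (has? i t h) ¬has)))))
      go nothing eq = cong₂ _+_ β≡ (trans (hit-nothing eq (lookup Q i)) (sym (hit-nothing eq c)))
        where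
        β≡ : β Q′ ≡ β Q
        β≡ with <-cmp (β Q′) (β Q)
        ... | tri≈ _ e _ = e
        ... | tri< lt _ _ = contradiction (frequent (has? i (lookup Q i)) (few₂ (has? i (lookup Q i)) (λ {h} e e′ →
                decidable-stable (has? i (lookup Q i) h) (λ ne → <⇒≱ lt (begin
                  β Q ≡⟨ sym e ⟩ matches Q h ≤⟨ m≤m+n _ _ ⟩ matches Q h + ι (c Fin.≟ lookup h i) ≡⟨ sym (change h) ⟩
                  matches Q′ h + ι (lookup Q i Fin.≟ lookup h i) ≡⟨ cong₂ _+_ e′ (ι-no (lookup Q i Fin.≟ lookup h i) (ne ∘ sym)) ⟩
                  β Q′ + 0 ≡⟨ +-identityʳ _ ⟩ β Q′ ∎))))) (τ-nothing eq (lookup Q i))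
          where open ≤-Reasoning
        ... | tri> _ _ gt = contradiction (frequent (has? i c) (few₂ (has? i c) (λ {h} e e′ →
                decidable-stable (has? i c h) (λ ne → <⇒≱ gt (begin
                  β Q′ ≡⟨ sym e′ ⟩ matches Q′ h ≤⟨ m≤m+n _ _ ⟩ matches Q′ h + ι (lookup Q i Fin.≟ lookup h i) ≡⟨ change h ⟩
                  matches Q h + ι (c Fin.≟ lookup h i) ≡⟨ cong₂ _+_ e (ι-no (c Fin.≟ lookup h i) (ne ∘ sym)) ⟩
                  β Q + 0 ≡⟨ +-identityʳ _ ⟩ β Q ∎))))) (τ-nothing eq c)
          where open ≤-Reasoning

    hits : Code n k → ℕ
    hits = weight hit

    β-hits : ∀ Q Q′ → β Q′ + hits Q ≡ β Q + hits Q′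
    β-hits = same-changes β hits (λ Q i c → +-cancelʳ-≡ (hit i (lookup Q i)) _ _ (begin
      (β (Q [ i ]≔ c) + hits Q) + hit i (lookup Q i)   ≡⟨ swap₂₃ (β (Q [ i ]≔ c)) _ _ ⟩
      (β (Q [ i ]≔ c) + hit i (lookup Q i)) + hits Q   ≡⟨ cong (_+ hits Q) (β-change Q i c) ⟩
      (β Q + hit i c) + hits Q                         ≡⟨ collect (β Q) (hit i c) (hits Q) ⟩
      β Q + (hits Q + hit i c)                         ≡⟨ cong (β Q +_) (sym (weight-update hit Q i c)) ⟩
      β Q + (hits (Q [ i ]≔ c) + hit i (lookup Q i))   ≡⟨ sym (+-assoc (β Q) _ _) ⟩
      (β Q + hits (Q [ i ]≔ c)) + hit i (lookup Q i)   ∎))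
      where
      open ≡-Reasoning
      swap₂₃ : ∀ a b c → (a + b) + c ≡ (a + c) + b
      swap₂₃ = solve-∀
      collect : ∀ a b c → (a + b) + c ≡ a + (c + b)
      collect = solve-∀

    other : Maybe (Fin k) → Fin k
    other (just c) = if does (c Fin.≟ x₀) then x₁ else x₀
    other nothing  = x₀

    -- A reference query: by `β-hits`, `β Q` is `β hitless` plus the hits of `Q`. Hence `b*` is at
    -- least the number of fixed letters, as `affected-half` requires.
    hitless : Code n k
    hitless = Vec.tabulate (other ∘ τ)

    hits-hitless : hits hitless ≡ 0
    hits-hitless = trans (sumF-cong n (λ i → trans (cong (hit i) (lookup∘tabulate (other ∘ τ) i)) (ι-no (is? i (other (τ i))) (differs (τ i))))) (sumF-0 n)
      where
      differs : ∀ t → t ≢ just (other t)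
      differs nothing ()
      differs (just c) eq with c Fin.≟ x₀
      ... | yes refl = x₀≢x₁ (Maybe.just-injective eq)
      ... | no ne = ne (Maybe.just-injective eq)

    coin : Fin k → Fin k → Maybe (Fin k) → Fin k × Fin k
    coin x y (just t) = t , t
    coin x y nothing  = x , y

    coins : Fin k → Fin k → Coins n k
    coins x y = Vec.tabulate (coin x y ∘ τ)

    module _ {x y : Fin k} (x≢y : x ≢ y) where

      coin-at : ∀ i → lookup (coins x y) i ≡ coin x y (τ i)
      coin-at = lookup∘tabulate (coin x y ∘ τ)

      hits-outcome : ∀ {Q} → Q ∈ outcomes (coins x y) → hits Q ≡ fixed (coins x y)
      hits-outcome {Q} m = sumF-cong n (λ i → letter i (τ i) refl
          (subst (λ p → lookup Q i ≡ proj₁ p ⊎ lookup Q i ≡ proj₂ p) (coin-at i) (outcome-letter (coins x y) m i)))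
        where
        letter : ∀ i t → τ i ≡ t → lookup Q i ≡ proj₁ (coin x y (τ i)) ⊎ lookup Q i ≡ proj₂ (coin x y (τ i)) →
          hit i (lookup Q i) ≡ ι (proj₁ (lookup (coins x y) i) Fin.≟ proj₂ (lookup (coins x y) i))
        letter i (just t) eq q rewrite coin-at i | eq = trans (ι-yes (Maybe.≡-dec Fin._≟_ (just t) (just (lookup Q i))) (cong just (sym ([ id , id ]′ q)))) (sym (ι-yes (t Fin.≟ t) refl))
        letter i nothing eq q rewrite coin-at i | eq = trans (ι-no (Maybe.≡-dec Fin._≟_ nothing (just (lookup Q i))) λ ()) (sym (ι-no (x Fin.≟ y) x≢y))

      b* : ℕ
      b* = β hitless + fixed (coins x y)

      β-outcome : ∀ {Q} → Q ∈ outcomes (coins x y) → β Q ≡ b*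
      β-outcome {Q} m = trans (sym (+-identityʳ (β Q))) (trans (cong (β Q +_) (sym hits-hitless))
        (trans (β-hits hitless Q) (cong (β hitless +_) (hits-outcome m))))

      -- An affected code is exceptional for at least half of the outcomes.
      disagree-few : count (¬? ∘ unaffected? (coins x y)) S ≤ g + g
      -- The factor `2 ^ n` is the number of outcomes; pairs of an outcome and a code exceptional
      -- for it are counted in both orders.
      disagree-few = *-cancelˡ-≤ (2 ^ n) {{m^n≢0 2 n}} (begin
        2 ^ n * count (¬? ∘ unaffected? cs) S
          ≡⟨ sym (sumL-* (2 ^ n) _ S) ⟩
        sumL (λ h → 2 ^ n * ι (¬? (unaffected? cs h))) S
          ≤⟨ sumL-mono S (λ {h} _ → half h (unaffected? cs h)) ⟩
        sumL (λ h → #exc h + #exc h) S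
          ≡⟨ sumL-+ #exc #exc S ⟩
        sumL #exc S + sumL #exc S
          ≡⟨ cong (λ t → t + t) (sym (sumL-comm (λ Q h → ι (exceptional? β μ Q h)) (outcomes cs) S)) ⟩
        sumL (λ Q → count (exceptional? β μ Q) S) (outcomes cs) + sumL (λ Q → count (exceptional? β μ Q) S) (outcomes cs)
          ≤⟨ +-mono-≤ all-few all-few ⟩
        2 ^ n * g + 2 ^ n * g
          ≡⟨ sym (*-distribˡ-+ (2 ^ n) g g) ⟩
        2 ^ n * (g + g) ∎)
        where
        open ≤-Reasoning
        cs : Coins n k
        cs = coins x y
        #exc : Code n k → ℕ
        #exc h = count (λ Q → exceptional? β μ Q h) (outcomes cs)
        all-few : sumL (λ Q → count (exceptional? β μ Q) S) (outcomes cs) ≤ 2 ^ n * g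
        all-few = ≤-trans (sumL-mono (outcomes cs) (λ {Q} _ → few Q))
          (≤-reflexive (trans (sumL-const g (outcomes cs)) (cong (_* g) (length-outcomes cs))))
        half : ∀ h (d : Dec (Unaffected cs h)) → 2 ^ n * ι (¬? d) ≤ #exc h + #exc h
        half h (yes _) = ≤-trans (≤-reflexive (*-zeroʳ (2 ^ n))) z≤n
        half h (no ¬ua) = ≤-trans (≤-reflexive (*-identityʳ (2 ^ n))) (+-cancelˡ-≤ (#matching cs h b* + #matching cs h b*) _ _ (begin
          (#matching cs h b* + #matching cs h b*) + 2 ^ n
            ≤⟨ +-monoˡ-≤ (2 ^ n) (affected-half cs h b* (m≤n+m _ _) ¬ua) ⟩
          2 ^ n + 2 ^ n
            ≡⟨ sym (cong₂ _+_ total-count total-count) ⟩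
          (#matching cs h b* + #other) + (#matching cs h b* + #other)
            ≡⟨ rearrange-+ (#matching cs h b*) #other _ _ ⟩
          (#matching cs h b* + #matching cs h b*) + (#other + #other)
            ≤⟨ +-monoʳ-≤ (#matching cs h b* + #matching cs h b*) (+-mono-≤ other≤ other≤) ⟩
          (#matching cs h b* + #matching cs h b*) + (#exc h + #exc h) ∎))
          where
          #other : ℕ
          #other = count (λ Q → ¬? (matches Q h ≟ b*)) (outcomes cs)
          total-count : #matching cs h b* + #other ≡ 2 ^ n
          total-count = trans (count-¬ (λ Q → matches Q h ≟ b*) (outcomes cs)) (length-outcomes cs)
          other≤ : #other ≤ #exc h
          other≤ = count-mono (λ Q → ¬? (matches Q h ≟ b*)) (λ Q → exceptional? β μ Q h) (outcomes cs)
            (λ {Q} m ne (eq , _) → ne (trans eq (β-outcome m)))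

    agreeing : ∀ {x y} (x≢y : x ≢ y) Q → ∃[ h ] (h ∈ S × Unaffected (coins x y) h × matches Q h ≡ β Q × common Q h ≡ μ Q)
    agreeing {x} {y} x≢y Q =
      let h , m , ¬¬ua , ne = avoid₂ (¬? ∘ unaffected? (coins x y)) (exceptional? β μ Q) S
            (≤-<-trans (+-mono-≤ (disagree-few x≢y) (≤-trans (few Q) (m≤m+n g g))) 4g)
      in h , m , decidable-stable (unaffected? (coins x y) h) ¬¬ua , typical Q h ne

    -- The constant of integration vanishes: for an outcome `Q₀`, a typical unaffected code matches
    -- exactly the fixed letters, and these are the hits of `Q₀`.
    β≡hits : ∀ Q → β Q ≡ hits Q
    β≡hits Q =
      let h , _ , ua , eq , _ = agreeing x₀≢x₁ Q₀
          Q₀-eq = trans (sym eq) (trans (unaffected-matches (coins x₀ x₁) {h} ua Q₀∈) (sym (hits-outcome x₀≢x₁ Q₀∈)))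
      in +-cancelʳ-≡ (hits Q₀) _ _ (trans (β-hits Q₀ Q) (trans (+-comm (β Q₀) _) (cong (hits Q +_) Q₀-eq)))
      where
      Q₀ : Code n k
      Q₀ = Vec.map proj₁ (coins x₀ x₁)
      Q₀∈ : Q₀ ∈ outcomes (coins x₀ x₁)
      Q₀∈ = first-outcome (coins x₀ x₁)

    frequency : Fin k → ℕ
    frequency c = sumF n (λ i → hit i c)

    Follows : Code n k → Set
    Follows h = ∀ {i t} → τ i ≡ just t → lookup h i ≡ t

    module _ {x y : Fin k} (x≢y : x ≢ y) {h : Code n k} (ua : Unaffected (coins x y) h) where

      unaffected-at : ∀ i → UnaffectedAt (coin x y (τ i)) (lookup h i)
      unaffected-at i = subst (λ p → UnaffectedAt p (lookup h i)) (coin-at x≢y i) (ua i)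

      follows : Follows h
      follows {i} {t} eq = [ proj₂ , (λ (ne , _) → contradiction refl ne) ]′
        (subst (λ m → UnaffectedAt (coin x y m) (lookup h i)) eq (unaffected-at i))

      avoids : ∀ {i} → τ i ≡ nothing → lookup h i ≢ x × lookup h i ≢ y
      avoids {i} eq = [ (λ (e , _) → contradiction e x≢y) , proj₂ ]′
        (subst (λ m → UnaffectedAt (coin x y m) (lookup h i)) eq (unaffected-at i))

      -- Outside the positions with majority letter, an unaffected code avoids both letters of the
      -- coins.
      occ-frequency : ∀ c → c ≡ x ⊎ c ≡ y → occ c h ≡ frequency c
      occ-frequency c cxy = sumF-cong n (λ i → letter i (τ i) refl)
        where
        letter : ∀ i t → τ i ≡ t → ι (lookup h i Fin.≟ c) ≡ hit i c
        letter i (just t) eq = trans (ι-cong (lookup h i Fin.≟ c) (c Fin.≟ lookup h i) sym sym) (sym (hit-just eq c (follows eq)))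
        letter i nothing eq = trans (ι-no (lookup h i Fin.≟ c) (λ e → [ (λ e′ → proj₁ (avoids eq) (trans e e′)) , (λ e′ → proj₂ (avoids eq) (trans e e′)) ]′ cxy))
          (sym (hit-nothing eq c))

    -- The size of the intersection with the multiset of all majority letters.
    capped : Code n k → ℕ
    capped Q = sumF k (λ c → occ c Q ⊓ frequency c)

    occ-update : ∀ (Q : Code n k) i d c → c ≢ d → c ≢ lookup Q i → occ c (Q [ i ]≔ d) ≡ occ c Q
    occ-update Q i d c c≢d c≢q = begin
      occ c (Q [ i ]≔ d)                             ≡⟨ sym (+-identityʳ _) ⟩
      occ c (Q [ i ]≔ d) + 0                         ≡⟨ cong (occ c (Q [ i ]≔ d) +_) (sym (ι-no (lookup Q i Fin.≟ c) (c≢q ∘ sym))) ⟩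
      occ c (Q [ i ]≔ d) + ι (lookup Q i Fin.≟ c)    ≡⟨ weight-update (λ _ q → ι (q Fin.≟ c)) Q i d ⟩
      occ c Q + ι (d Fin.≟ c)                        ≡⟨ cong (occ c Q +_) (ι-no (d Fin.≟ c) (c≢d ∘ sym)) ⟩
      occ c Q + 0                                    ≡⟨ +-identityʳ _ ⟩
      occ c Q                                        ∎
      where open ≡-Reasoning

    -- Coins between the old and the new letter are used: a code that they do not affect and that is
    -- typical for both queries contains these two letters exactly `frequency` times. No other
    -- letter changes its number of occurrences in the query.
    μ-change : ∀ Q i d → μ (Q [ i ]≔ d) + capped Q ≡ μ Q + capped (Q [ i ]≔ d)
    μ-change Q i d = go (d Fin.≟ lookup Q i)
      where
      open ≡-Reasoning
      Q′ : Code n k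
      Q′ = Q [ i ]≔ d
      letter : d ≢ lookup Q i → ∀ h → Unaffected (coins d (lookup Q i)) h → ∀ c → Dec (c ≡ d) → Dec (c ≡ lookup Q i) →
        occ c Q′ ⊓ occ c h + occ c Q ⊓ frequency c ≡ occ c Q ⊓ occ c h + occ c Q′ ⊓ frequency c
      letter d≢q h ua c (yes e) _ = exchange (occ-frequency d≢q {h} ua c (inj₁ e))
        where
        exchange : ∀ {o} → o ≡ frequency c → occ c Q′ ⊓ o + occ c Q ⊓ frequency c ≡ occ c Q ⊓ o + occ c Q′ ⊓ frequency c
        exchange refl = +-comm (occ c Q′ ⊓ frequency c) _
      letter d≢q h ua c (no _) (yes e) = exchange (occ-frequency d≢q {h} ua c (inj₂ e))
        where
        exchange : ∀ {o} → o ≡ frequency c → occ c Q′ ⊓ o + occ c Q ⊓ frequency c ≡ occ c Q ⊓ o + occ c Q′ ⊓ frequency c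
        exchange refl = +-comm (occ c Q′ ⊓ frequency c) _
      letter d≢q h ua c (no c≢d) (no c≢q) = cong₂ (λ a b → a ⊓ occ c h + b ⊓ frequency c) (occ-update Q i d c c≢d c≢q) (sym (occ-update Q i d c c≢d c≢q))
      go : Dec (d ≡ lookup Q i) → μ Q′ + capped Q ≡ μ Q + capped Q′
      go (yes eq) = cong₂ (λ A B → μ A + capped B) unchanged (sym unchanged)
        where
        unchanged : Q′ ≡ Q
        unchanged = trans (cong (Q [ i ]≔_) eq) ([]≔-lookup Q i)
      go (no d≢q) =
        let h , _ , ¬¬ua , e , e′ = avoid₃ (¬? ∘ unaffected? (coins d (lookup Q i))) (exceptional? β μ Q) (exceptional? β μ Q′) S
                    (≤-<-trans (+-mono-≤ (disagree-few d≢q) (+-mono-≤ (few Q) (few Q′))) 4g)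
            ua = decidable-stable (unaffected? (coins d (lookup Q i)) h) ¬¬ua
        in begin
        μ Q′ + capped Q                                                    ≡⟨ cong (_+ capped Q) (sym (proj₂ (typical Q′ h e′))) ⟩
        common Q′ h + capped Q                                             ≡⟨ sym (sumF-+ k _ _) ⟩
        sumF k (λ c → occ c Q′ ⊓ occ c h + occ c Q ⊓ frequency c)          ≡⟨ sumF-cong k (λ c → letter d≢q h ua c (c Fin.≟ d) (c Fin.≟ lookup Q i)) ⟩
        sumF k (λ c → occ c Q ⊓ occ c h + occ c Q′ ⊓ frequency c)          ≡⟨ sumF-+ k _ _ ⟩
        common Q h + capped Q′                                             ≡⟨ cong (_+ capped Q′) (proj₂ (typical Q h e)) ⟩
        μ Q + capped Q′                                                    ∎

    μ≡capped : ∀ Q → μ Q ≡ capped Q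
    μ≡capped Q =
      let h , _ , ua , _ , eq = agreeing x₀≢x₁ Q₀
      in +-cancelʳ-≡ (capped Q₀) _ _ (trans (same-changes μ capped μ-change Q₀ Q) (trans (+-comm (μ Q₀) _) (cong (capped Q +_)
        (trans (sym eq) (sumF-cong k (λ c → letter h ua c (c Fin.≟ x₀)))))))
      where
      Q₀ : Code n k
      -- Only `x₀` occurs in this query, and its number of occurrences in an unaffected code is
      -- known; this fixes the constant of integration.
      Q₀ = Vec.replicate n x₀
      letter : ∀ h → Unaffected (coins x₀ x₁) h → ∀ c → Dec (c ≡ x₀) → occ c Q₀ ⊓ occ c h ≡ occ c Q₀ ⊓ frequency c
      letter h ua c (yes e) = cong (occ c Q₀ ⊓_) (occ-frequency x₀≢x₁ {h} ua c (inj₁ e))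
      letter h ua c (no c≢x₀) = trans (cong (_⊓ occ c h) absent) (sym (cong (_⊓ frequency c) absent))
        where
        absent : occ c Q₀ ≡ 0
        absent = trans (sumF-cong n (λ i → ι-no (lookup Q₀ i Fin.≟ c) (λ e → c≢x₀ (trans (sym e) (lookup-replicate i x₀))))) (sumF-0 n)

    frequency≤occ : ∀ h → Follows h → ∀ c → frequency c ≤ occ c h
    frequency≤occ h fol c = sumF-mono n (λ i → ι-mono (is? i c) (lookup h i Fin.≟ c) fol)

    -- A code with all majority letters has at least `hits Q` matches and `capped Q` common letters.
    -- Its letter at `i₀` comes in addition, so noticing it makes one of the two numbers strictly
    -- larger than typical.
    detected : ∀ {i₀} → τ i₀ ≡ nothing → ∀ {Q h c} → Follows h → lookup h i₀ ≡ c → Tests frequency i₀ Q c → Exceptional β μ Q h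
    detected {i₀} none {Q} {h} {c} fol hc (inj₂ Qc) (eq , _) =
      <⇒≢ (sumF-mono-< n (λ i → ι-mono (is? i (lookup Q i)) (lookup Q i Fin.≟ lookup h i) (sym ∘ fol)) i₀
            (subst₂ _<_ (sym (hit-nothing none (lookup Q i₀))) (sym (ι-yes (lookup Q i₀ Fin.≟ lookup h i₀) (trans Qc (sym hc)))) (s≤s z≤n)))
          (sym (trans eq (β≡hits Q)))
    detected {i₀} none {Q} {h} {c} fol hc (inj₁ more) (_ , eq) =
      <⇒≢ (sumF-mono-< k (λ d → ⊓-monoʳ-≤ (occ d Q) (frequency≤occ h fol d)) c
            (≤-<-trans (m⊓n≤n (occ c Q) _) (⊓-glb more
              (sumF-mono-< n (λ i → ι-mono (is? i c) (lookup h i Fin.≟ c) fol) i₀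
                (subst₂ _<_ (sym (hit-nothing none c)) (sym (ι-yes (lookup h i₀ Fin.≟ c) hc)) (s≤s z≤n))))))
          (sym (trans eq (μ≡capped Q)))

    -- Otherwise all unaffected codes coincide, so `S` has at most `1 + (g + g)` elements. As it has
    -- more than `4 * g`, this leaves `g` zero and a single code.
    undecided : ∃[ i ] τ i ≡ nothing
    undecided = go (Fin.any? (λ i → Maybe.≡-dec Fin._≟_ (τ i) nothing))
      where
      value : ∀ t → t ≢ nothing → ∃[ c ] t ≡ just c
      value (just c) _ = c , refl
      value nothing ne = contradiction refl ne
      small : ∀ g → length S ≤ 1 + (g + g) → g + g + (g + g) < length S → length S ≤ 1
      small zero    le lt = le
      small (suc g) le lt = contradiction (<-≤-trans lt le) (≤⇒≯ (s≤s (m≤n+m (suc g + suc g) (g + suc g))))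
      go : Dec (∃[ i ] τ i ≡ nothing) → ∃[ i ] τ i ≡ nothing
      go (yes found) = found
      go (no ∄) = contradiction 2≤ (<⇒≱ (s≤s (small g (≤-trans (≤-reflexive (sym (count-¬ (unaffected? (coins x₀ x₁)) S)))
                    (+-mono-≤ (count-≡ unique (unaffected? (coins x₀ x₁)) (λ {h} ua → determined h ua)) (disagree-few x₀≢x₁))) 4g)))
        where
        τ-value : ∀ i → ∃[ c ] τ i ≡ just c
        τ-value i = value (τ i) (λ eq → ∄ (i , eq))
        determined : ∀ h → Unaffected (coins x₀ x₁) h → h ≡ Vec.tabulate (proj₁ ∘ τ-value)
        determined h ua = trans (sym (tabulate∘lookup h)) (tabulate-cong (λ i → follows x₀≢x₁ {h} ua (proj₂ (τ-value i))))

-- Noticing the letters at one position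

letter-functional : ∀ {n k} → Fin n → Fin k → Fin n → Fin k → ℕ
letter-functional i c j d = ι (j Fin.≟ i) * ι (d Fin.≟ c)

weight-letter : ∀ {n k} (i : Fin n) (c : Fin k) h → weight (letter-functional i c) h ≡ ι (lookup h i Fin.≟ c)
weight-letter {n} i c h = sumF-δ n (λ j → ι (lookup h j Fin.≟ c)) i

-- With a code carrying the first letter as base point, the indicators of the other letters and
-- codes carrying them form a triangular system.
rank-letters : ∀ {n k d} {S : List (Code n k)} → RankLe S d → ∀ i (cs : List (Fin k)) → List.Unique cs →
  All (λ c → ∃[ h ] (h ∈ S × lookup h i ≡ c)) cs → length cs ≤ suc d
rank-letters rk i [] _ _ = z≤n
rank-letters {n} {k} {d} {S} rk i (c₀ ∷ cs) (c₀∉ ∷ u) ((h₀ , h₀∈ , e₀) ∷ reps) =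
  s≤s (subst (_≤ d) (length-pairs cs reps) (rk h₀∈ (pairs cs reps) (diagonal cs c₀∉ reps , triangular cs c₀∉ u reps)))
  where
  Rep : Fin k → Set
  Rep c = ∃[ h ] (h ∈ S × lookup h i ≡ c)
  functional : Fin k → Functional n k
  functional c j d = pos (letter-functional i c j d)
  value : ∀ c {c′} h → lookup h i ≡ c′ → eval (functional c) h ≡ pos (ι (c′ Fin.≟ c))
  value c h refl = trans (eval-weight (letter-functional i c) h) (cong pos (weight-letter i c h))
  pairs : ∀ cs → All Rep cs → List (Functional n k × Code n k)
  pairs [] [] = []
  pairs (c ∷ cs) ((h , _) ∷ reps) = (functional c , h) ∷ pairs cs reps
  length-pairs : ∀ cs (reps : All Rep cs) → length (pairs cs reps) ≡ length cs
  length-pairs [] [] = refl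
  length-pairs (c ∷ cs) (_ ∷ reps) = cong suc (length-pairs cs reps)
  diagonal : ∀ cs → All (c₀ ≢_) cs → (reps : All Rep cs) →
    All (λ p → proj₂ p ∈ S × eval (proj₁ p) (proj₂ p) ≢ eval (proj₁ p) h₀) (pairs cs reps)
  diagonal [] [] [] = []
  diagonal (c ∷ cs) (c₀≢c ∷ ne) ((h , h∈ , e) ∷ reps) = (h∈ , λ eq → 1+n≢0 (ℤ.+-injective (begin
      pos 1               ≡⟨ cong pos (sym (ι-yes (c Fin.≟ c) refl)) ⟩
      pos (ι (c Fin.≟ c))   ≡⟨ sym (value c h e) ⟩
      eval (functional c) h  ≡⟨ eq ⟩
      eval (functional c) h₀ ≡⟨ value c h₀ e₀ ⟩
      pos (ι (c₀ Fin.≟ c))  ≡⟨ cong pos (ι-no (c₀ Fin.≟ c) c₀≢c) ⟩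
      pos 0               ∎))) ∷ diagonal cs ne reps
    where open ≡-Reasoning
  zeros : ∀ c → c₀ ≢ c → ∀ cs → All (c ≢_) cs → (reps : All Rep cs) →
    All (λ q → eval (functional c) (proj₂ q) ≡ eval (functional c) h₀) (pairs cs reps)
  zeros c c₀≢c [] [] [] = []
  zeros c c₀≢c (c′ ∷ cs) (c≢c′ ∷ ne) ((h , _ , e) ∷ reps) =
    trans (value c h e) (trans (cong pos (trans (ι-no (c′ Fin.≟ c) (c≢c′ ∘ sym)) (sym (ι-no (c₀ Fin.≟ c) c₀≢c)))) (sym (value c h₀ e₀)))
    ∷ zeros c c₀≢c cs ne reps
  triangular : ∀ cs → All (c₀ ≢_) cs → List.Unique cs → (reps : All Rep cs) →
    AllPairs (λ p q → eval (proj₁ p) (proj₂ q) ≡ eval (proj₁ p) h₀) (pairs cs reps)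
  triangular [] [] [] [] = []
  triangular (c ∷ cs) (c₀≢c ∷ ne) (c∉ ∷ u) (_ ∷ reps) = zeros c c₀≢c cs c∉ reps ∷ triangular cs ne u reps

covered-length : {A B : Set} {P : A → Set} {E : B → A → Set} (P? : ∀ x → Dec (P x)) (E? : ∀ q x → Dec (E q x))
  (xs : List A) (qs : List B) → (∀ {x} → x ∈ xs → P x ⊎ Any (λ q → E q x) qs) →
  length xs ≤ count P? xs + sumL (λ q → count (E? q) xs) qs
covered-length P? E? xs qs cov = begin
  length xs                                                        ≡⟨ sym (trans (sumL-const 1 xs) (*-identityʳ _)) ⟩
  sumL (λ _ → 1) xs                                                ≤⟨ sumL-mono xs (λ {x} m → one x (cov m)) ⟩
  sumL (λ x → ι (P? x) + sumL (λ q → ι (E? q x)) qs) xs            ≡⟨ sumL-+ _ _ xs ⟩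
  count P? xs + sumL (λ x → sumL (λ q → ι (E? q x)) qs) xs         ≡⟨ cong (count P? xs +_) (sumL-comm (λ x q → ι (E? q x)) xs qs) ⟩
  count P? xs + sumL (λ q → count (E? q) xs) qs                    ∎
  where
  open ≤-Reasoning
  one : ∀ x → _ → 1 ≤ ι (P? x) + sumL (λ q → ι (E? q x)) qs
  one x (inj₁ p) = ≤-trans (≤-reflexive (sym (ι-yes (P? x) p))) (m≤m+n _ _)
  one x (inj₂ any) = ≤-trans (some any) (m≤n+m _ _)
    where
    some : ∀ {qs} → Any _ qs → 1 ≤ sumL (λ q → ι (E? q x)) qs
    some {q ∷ _} (here e) = ≤-trans (≤-reflexive (sym (ι-yes (E? q x) e))) (m≤m+n _ _)
    some (there any) = ≤-trans (some any) (m≤n+m _ _)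

pad : ∀ {k} m → List (Fin k) → Fin k → Code m k
pad zero    _        c = []
pad (suc m) []       c = c ∷ pad m [] c
pad (suc m) (x ∷ xs) c = x ∷ pad m xs c

occ-pad : ∀ {k} m (xs : List (Fin k)) c x → length xs ≤ m → count (Fin._≟ x) xs ≤ occ x (pad m xs c)
occ-pad m [] c x _ = z≤n
occ-pad (suc m) (y ∷ xs) c x le = +-monoʳ-≤ (ι (y Fin.≟ x)) (occ-pad m xs c x (s≤s⁻¹ le))

occ-insertAt : ∀ {m k} (v : Code m k) i c x → occ x v ≤ occ x (Vec.insertAt v i c)
occ-insertAt v zero c x = m≤n+m _ _
occ-insertAt (y ∷ v) (suc i) c x = +-monoʳ-≤ (ι (y Fin.≟ x)) (occ-insertAt v i c x)

-- Letters are packed greedily into queries, c requiring more than w c copies; a letter that does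
-- not fit any more is tested by a black peg at position i₀ of the query that it completes.
module Packing {n k : ℕ} (w : Fin k → ℕ) (i₀ : Fin (suc n)) where

  fill : List (Fin k) → Fin k → Code (suc n) k
  fill xs c = Vec.insertAt (pad n xs c) i₀ c

  occ-fill : ∀ xs c x → length xs ≤ n → count (Fin._≟ x) xs ≤ occ x (fill xs c)
  occ-fill xs c x le = ≤-trans (occ-pad n xs c x le) (occ-insertAt (pad n xs c) i₀ c x)

  count-replicate : ∀ m (c : Fin k) → count (Fin._≟ c) (replicate m c) ≡ m
  count-replicate zero    c = refl
  count-replicate (suc m) c = cong₂ _+_ (ι-yes (c Fin.≟ c) refl) (count-replicate m c)

  -- The list `xs` holds the copies already placed in the current query, so its letters with enough
  -- copies must be tested too. Each query is paid for by `suc n` units of the budget, except that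
  -- the last may cost less.
  pack : ∀ cs xs p → length xs ≤ n → length xs + sumL (λ c → suc (w c)) cs ≤ p * suc n →
    ∃[ Qs ] (length Qs ≤ p × (∀ {c} → c ∈ cs → Any (λ Q → Tests w i₀ Q c) Qs) ×
      (∀ c → w c < count (Fin._≟ c) xs → Any (λ Q → Tests w i₀ Q c) Qs))
  pack [] [] p _ _ = [] , z≤n , (λ ()) , λ _ ()
  pack [] (x ∷ xs) (suc p) le _ = fill (x ∷ xs) x ∷ [] , s≤s z≤n , (λ ()) ,
    λ c lt → here (inj₁ (<-≤-trans lt (occ-fill (x ∷ xs) x c le)))
  pack (c ∷ cs) xs p le budget with length xs + suc (w c) ≤? n
  ... | yes fits =
    let xs′ = replicate (suc (w c)) c ++ xs
        len = trans (length-++ (replicate (suc (w c)) c) {xs}) (cong (_+ length xs) (length-replicate (suc (w c))))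
        Qs , short , tests , kept = pack cs xs′ p
          (≤-trans (≤-reflexive (trans len (+-comm (suc (w c)) (length xs)))) fits)
          (≤-trans (≤-reflexive (trans (cong (_+ sumL (λ c → suc (w c)) cs) len) (shuffle (suc (w c)) (length xs) _))) budget)
    in Qs , short ,
       (λ { (here refl) → kept c (≤-trans (≤-reflexive (sym (count-replicate (suc (w c)) c)))
                            (≤-trans (m≤m+n _ _) (≤-reflexive (sym (sumL-++ _ (replicate (suc (w c)) c) xs)))))
          ; (there m) → tests m }) ,
       (λ c′ lt → kept c′ (<-≤-trans lt (≤-trans (m≤n+m _ _) (≤-reflexive (sym (sumL-++ _ (replicate (suc (w c)) c) xs))))))
    where
    shuffle : ∀ a b c → (a + b) + c ≡ b + (a + c)
    shuffle = solve-∀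
  pack (c ∷ cs) xs zero le budget | no _ with () ← ≤-trans (≤-trans (m≤m+n (suc (w c)) _) (m≤n+m _ (length xs))) budget
  -- The copies of `c` together with `xs` exceed `n`, which pays for the query completed here;
  -- position `i₀` has been kept free for `c`.
  pack (c ∷ cs) xs (suc p) le budget | no full =
    let Qs , short , tests , _ = pack cs [] p z≤n (+-cancelˡ-≤ (suc n) _ _
          (≤-trans (+-monoˡ-≤ _ (≰⇒> full)) (≤-trans (≤-reflexive (+-assoc (length xs) _ _)) budget)))
    in fill xs c ∷ Qs , s≤s short ,
       (λ { (here refl) → here (inj₂ (insertAt-lookup (pad n xs c) i₀ c)) ; (there m) → there (tests m) }) ,
       (λ c′ lt → here (inj₁ (<-≤-trans lt (occ-fill xs c c′ le))))

sumL-filter : ∀ {A : Set} {P : A → Set} (P? : Decidable P) (f : A → ℕ) xs → sumL f (filter P? xs) ≤ sumL f xs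
sumL-filter P? f [] = z≤n
sumL-filter P? f (x ∷ xs) with P? x
... | yes _ = +-monoʳ-≤ (f x) (sumL-filter P? f xs)
... | no _  = ≤-trans (sumL-filter P? f xs) (m≤n+m _ _)

module _ {n k k₂ d : ℕ} (k≤ : k ≤ 2 + k₂) (x₀ x₁ : Fin k) (x₀≢x₁ : x₀ ≢ x₁)
  (S : List (Code (suc n) k)) (unique : List.Unique S) (2≤ : 2 ≤ length S) (rk : RankLe S (suc d))
  (g : ℕ) (β μ : Code (suc n) k → ℕ) (quiet : 4 * g < length S)
  (few : ∀ Q → count (exceptional? β μ Q) S ≤ g) where

  open Concentrated x₀ x₁ x₀≢x₁ S unique 2≤ g β μ quiet few
  module Bound (τ : Fin (suc n) → Maybe (Fin k)) (τ-just : ∀ {i c} → τ i ≡ just c → Dominant i c)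
    (τ-nothing : ∀ {i} → τ i ≡ nothing → ∀ c → ¬ Dominant i c) where
    open Template τ τ-just τ-nothing

    i₀ : Fin (suc n)
    i₀ = proj₁ undecided

    open Packing frequency i₀ using (pack)

    occurs? : ∀ c → Dec (Any (λ h → lookup h i₀ ≡ c) S)
    occurs? c = Any.any? (λ h → lookup h i₀ Fin.≟ c) S

    letters : List (Fin k)
    letters = filter occurs? (allFin k)

    -- One bound comes from the size of the alphabet, the other from the rank `suc d`.
    length-letters : length letters ≤ 2 + (k₂ ⊓ d)
    length-letters = ⊓-glb
      (≤-trans (length-filter occurs? (allFin k)) (≤-trans (≤-reflexive (length-tabulate {n = k} id)) k≤))
      (rank-letters rk i₀ letters (Unique.filter⁺ occurs? (Unique.allFin⁺ k))
        (All.tabulate (λ {c} m → find (proj₂ (∈-filter⁻ occurs? {xs = allFin k} m)))))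

    -- Each position has at most one majority letter, and `i₀` has none.
    frequency-total : sumF k frequency ≤ n
    frequency-total = s≤s⁻¹ (≤-trans (≤-reflexive (cong suc (sumF-comm k (suc n) (λ c i → hit i c))))
      (≤-trans (sumF-mono-< (suc n) (λ i → once i (τ i) refl) i₀
        (s≤s (≤-reflexive (trans (sumF-cong k (hit-nothing (proj₂ undecided))) (sumF-0 k)))))
        (≤-reflexive (trans (sumF-const (suc n) 1) (*-identityʳ (suc n))))))
      where
      once : ∀ i t → τ i ≡ t → sumF k (hit i) ≤ 1
      once i (just t) eq = ≤-reflexive (trans (sumF-cong k (λ c → hit-just eq c refl)) (sumF-δ1 k t))
      once i nothing eq = ≤-trans (≤-reflexive (trans (sumF-cong k (hit-nothing eq)) (sumF-0 k))) z≤n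

    m p : ℕ
    m = k₂ ⊓ d
    p = 2 + m / suc n

    budget : sumL (λ c → suc (frequency c)) letters ≤ p * suc n
    budget = begin
      sumL (λ c → suc (frequency c)) letters                     ≡⟨ sumL-+ (λ _ → 1) frequency letters ⟩
      sumL (λ _ → 1) letters + sumL frequency letters            ≤⟨ +-mono-≤ (≤-reflexive (trans (sumL-const 1 letters) (*-identityʳ _)))
                                                                     (≤-trans (sumL-filter occurs? frequency (allFin k)) (≤-trans (≤-reflexive (sumL-tabulate frequency k id)) frequency-total)) ⟩
      length letters + n                                         ≤⟨ +-monoˡ-≤ n length-letters ⟩
      2 + m + n                                                  ≡⟨ cong (λ t → 2 + t + n) (m≡m%n+[m/n]*n m (suc n)) ⟩
      -- The remainder is at most `n`; with the other `n` and the 2 it fills the two extra queries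
      -- in `p`.
      2 + (m % suc n + m / suc n * suc n) + n                    ≤⟨ +-monoˡ-≤ n (+-monoʳ-≤ 2 (+-monoˡ-≤ (m / suc n * suc n) (s≤s⁻¹ (m%n<n m (suc n))))) ⟩
      2 + (n + m / suc n * suc n) + n                            ≡⟨ collect n (m / suc n * suc n) ⟩
      p * suc n                                                  ∎
      where
      open ≤-Reasoning
      collect : ∀ n a → 2 + (n + a) + n ≡ suc n + (suc n + a)
      collect = solve-∀

    -- A code of `S` is affected by the coins, which costs `g + g`, or its letter at `i₀` is noticed
    -- by one of at most `p` queries, each costing `g`.
    bound : length S ≤ (4 + (k₂ ⊓ d) / suc n) * g
    bound =
      let Qs , short , tests , _ = pack letters [] p z≤n budget
          covered : ∀ {h} → h ∈ S → ¬ Unaffected (coins x₀ x₁) h ⊎ Any (λ Q → Exceptional β μ Q h) Qs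
          covered {h} h∈ = cover Qs tests h h∈ (unaffected? (coins x₀ x₁) h)
      in begin
        length S
          ≤⟨ covered-length (¬? ∘ unaffected? (coins x₀ x₁)) (exceptional? β μ) S Qs covered ⟩
        count (¬? ∘ unaffected? (coins x₀ x₁)) S + sumL (λ Q → count (exceptional? β μ Q) S) Qs
          ≤⟨ +-mono-≤ (disagree-few x₀≢x₁) (≤-trans (sumL-mono Qs (λ {Q} _ → few Q)) (≤-trans (≤-reflexive (sumL-const g Qs)) (*-monoˡ-≤ g short))) ⟩
        (g + g) + p * g
          ≡⟨ collect g (m / suc n * g) ⟩
        (4 + m / suc n) * g ∎
      where
      open ≤-Reasoning
      collect : ∀ g a → (g + g) + (g + (g + a)) ≡ g + (g + (g + (g + a)))
      collect = solve-∀
      cover : ∀ Qs → (∀ {c} → c ∈ letters → Any (λ Q → Tests frequency i₀ Q c) Qs) → ∀ h → h ∈ S → Dec (Unaffected (coins x₀ x₁) h) →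
        ¬ Unaffected (coins x₀ x₁) h ⊎ Any (λ Q → Exceptional β μ Q h) Qs
      cover Qs tests h h∈ (no ¬ua) = inj₁ ¬ua
      cover Qs tests h h∈ (yes ua) = inj₂ (Any.map (λ {Q} test → detected (proj₂ undecided) {Q} {h} (follows x₀≢x₁ {h} ua) refl test)
        (tests (∈-filter⁺ occurs? (∈-allFin (lookup h i₀)) (lose h∈ refl))))

  quiet-bound : length S ≤ (4 + (k₂ ⊓ d) / suc n) * g
  quiet-bound = Bound.bound majority majority-just majority-nothing

-- The initial potential

prod : (ℕ → ℕ) → ℕ → ℕ
prod f zero    = 1
prod f (suc m) = prod f m * f m

^-distribʳ-* : ∀ m a b → (a * b) ^ m ≡ a ^ m * b ^ m
^-distribʳ-* zero    a b = refl
^-distribʳ-* (suc m) a b = trans (cong (a * b *_) (^-distribʳ-* m a b)) (interchange a b (a ^ m) (b ^ m))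
  where
  interchange : ∀ a b c d → a * b * (c * d) ≡ a * c * (b * d)
  interchange = solve-∀

-- The number N (N - 1), defined without truncated subtraction.
pronic : ℕ → ℕ
pronic zero    = 0
pronic (suc N) = pronic N + 2 * N

pronic-suc : ∀ N → pronic (suc N) ≡ suc N * N
pronic-suc zero    = refl
pronic-suc (suc N) = trans (cong (_+ 2 * suc N) (pronic-suc N)) (expand N)
  where
  expand : ∀ N → suc N * N + 2 * suc N ≡ suc (suc N) * suc N
  expand = solve-∀

-- The first three terms of the binomial expansion of (x + 1)^N, multiplied by 2 x².
bernoulli₂ : ∀ x N → x ^ N * (2 * (x * x) + 2 * N * x + pronic N) ≤ 2 * (x * x) * suc x ^ N
bernoulli₂ x zero = ≤-reflexive (expand x)
  where
  expand : ∀ x → 1 * (2 * (x * x) + 0 + 0) ≡ 2 * (x * x) * 1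
  expand = solve-∀
bernoulli₂ x (suc N) = begin
  x * x ^ N * (2 * (x * x) + 2 * suc N * x + (pronic N + 2 * N))
    ≤⟨ m≤m+n _ (x ^ N * pronic N) ⟩
  x * x ^ N * (2 * (x * x) + 2 * suc N * x + (pronic N + 2 * N)) + x ^ N * pronic N
    ≡⟨ collect x (x ^ N) N (pronic N) ⟩
  suc x * (x ^ N * (2 * (x * x) + 2 * N * x + pronic N))
    ≤⟨ *-monoʳ-≤ (suc x) (bernoulli₂ x N) ⟩
  suc x * (2 * (x * x) * suc x ^ N)
    ≡⟨ exchange (suc x) (2 * (x * x)) (suc x ^ N) ⟩
  2 * (x * x) * (suc x * suc x ^ N) ∎
  where
  open ≤-Reasoning
  collect : ∀ x y N t → x * y * (2 * (x * x) + 2 * suc N * x + (t + 2 * N)) + y * t ≡ suc x * (y * (2 * (x * x) + 2 * N * x + t))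
  collect = solve-∀
  exchange : ∀ a b c → a * (b * c) ≡ b * (a * c)
  exchange = solve-∀

-- (c − 2) (c − 3) ≥ 0
5c≤c²+6 : ∀ c → 5 * c ≤ c * c + 6
5c≤c²+6 0 = z≤n
5c≤c²+6 1 = m≤m+n 5 2
5c≤c²+6 2 = m≤m+n 10 0
5c≤c²+6 (suc (suc (suc t))) = ≤-trans (m≤m+n _ (t * t + t)) (≤-reflexive (expand t))
  where
  expand : ∀ t → 5 * (3 + t) + (t * t + t) ≡ (3 + t) * (3 + t) + 6
  expand = solve-∀

-- Three terms of the binomial expansion are just enough: what they leave to prove is (c - 2) (c -
-- 3) ≥ 0.
core-base : ∀ c → 3 * (2 + (c + 2 * c)) * (3 + c) ^ (2 * c) ≤ 2 * (4 + c) ^ suc (2 * c)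
core-base c = *-cancelʳ-≤ _ _ (x * x) (begin
  3 * (2 + (c + 2 * c)) * x ^ (2 * c) * (x * x)
    ≡⟨ collect c x (x ^ (2 * c)) ⟩
  x * x ^ (2 * c) * ((6 + 9 * c) * x)
    ≤⟨ *-monoʳ-≤ (x * x ^ (2 * c)) quadratic ⟩
  x * x ^ (2 * c) * (2 * (x * x) + 2 * suc (2 * c) * x + suc (2 * c) * (2 * c))
    ≡⟨ cong (λ t → x * x ^ (2 * c) * (2 * (x * x) + 2 * suc (2 * c) * x + t)) (sym (pronic-suc (2 * c))) ⟩
  x ^ suc (2 * c) * (2 * (x * x) + 2 * suc (2 * c) * x + pronic (suc (2 * c)))
    ≤⟨ bernoulli₂ x (suc (2 * c)) ⟩
  2 * (x * x) * suc x ^ suc (2 * c)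
    ≡⟨ exchange (x * x) (suc x ^ suc (2 * c)) ⟩
  2 * suc x ^ suc (2 * c) * (x * x) ∎)
  where
  open ≤-Reasoning
  x : ℕ
  x = 3 + c
  collect : ∀ c x y → 3 * (2 + (c + 2 * c)) * y * (x * x) ≡ x * y * ((6 + 9 * c) * x)
  collect = solve-∀
  exchange : ∀ a b → 2 * a * b ≡ 2 * b * a
  exchange = solve-∀
  quadratic : (6 + 9 * c) * x ≤ 2 * (x * x) + 2 * suc (2 * c) * x + suc (2 * c) * (2 * c)
  quadratic = begin
    (6 + 9 * c) * (3 + c)                              ≡⟨ expand₁ c ⟩
    (9 * (c * c) + 28 * c + 18) + 5 * c                ≤⟨ +-monoʳ-≤ (9 * (c * c) + 28 * c + 18) (5c≤c²+6 c) ⟩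
    (9 * (c * c) + 28 * c + 18) + (c * c + 6)          ≡⟨ expand₂ c ⟩
    2 * ((3 + c) * (3 + c)) + 2 * suc (2 * c) * (3 + c) + suc (2 * c) * (2 * c) ∎
    where
    expand₁ : ∀ c → (6 + 9 * c) * (3 + c) ≡ (9 * (c * c) + 28 * c + 18) + 5 * c
    expand₁ = solve-∀
    expand₂ : ∀ c → (9 * (c * c) + 28 * c + 18) + (c * c + 6) ≡ 2 * ((3 + c) * (3 + c)) + 2 * suc (2 * c) * (3 + c) + suc (2 * c) * (2 * c)
    expand₂ = solve-∀

-- The left-hand side grows by the factor (3 + c) (3 + c + e) / (2 + c + e), which is at most 4 + c
-- since e ≥ 1.
core-step : ∀ c e → 1 ≤ e → 3 * (2 + (c + e)) * (3 + c) ^ e ≤ 2 * (4 + c) ^ suc e →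
  3 * (2 + (c + suc e)) * (3 + c) ^ suc e ≤ 2 * (4 + c) ^ suc (suc e)
core-step c (suc e) _ ih = begin
  3 * (2 + (c + suc (suc e))) * ((3 + c) * (3 + c) ^ suc e)
    ≤⟨ m≤m+n _ (3 * e * (3 + c) ^ suc e) ⟩
  3 * (2 + (c + suc (suc e))) * ((3 + c) * (3 + c) ^ suc e) + 3 * e * (3 + c) ^ suc e
    ≡⟨ collect c e ((3 + c) ^ suc e) ⟩
  (4 + c) * (3 * (2 + (c + suc e)) * (3 + c) ^ suc e)
    ≤⟨ *-monoʳ-≤ (4 + c) ih ⟩
  (4 + c) * (2 * (4 + c) ^ suc (suc e))
    ≡⟨ exchange (4 + c) ((4 + c) ^ suc (suc e)) ⟩
  2 * ((4 + c) * (4 + c) ^ suc (suc e)) ∎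
  where
  open ≤-Reasoning
  collect : ∀ c e y → 3 * (2 + (c + suc (suc e))) * ((3 + c) * y) + 3 * e * y ≡ (4 + c) * (3 * (2 + (c + suc e)) * y)
  collect = solve-∀
  exchange : ∀ a b → a * (2 * b) ≡ 2 * (a * b)
  exchange = solve-∀

core : ∀ c f → 3 * (2 + (c + (f + 2 * c))) * (3 + c) ^ (f + 2 * c) ≤ 2 * (4 + c) ^ suc (f + 2 * c)
core c zero = core-base c
-- For `c` zero the base case has exponent 0, where `core-step` does not apply; the inequality is 27
-- ≤ 32.
core zero (suc zero) = m≤m+n 27 5
core (suc c) (suc zero) = core-step (suc c) (2 * suc c) (s≤s z≤n) (core-base (suc c))
core c (suc (suc f)) = core-step c (suc f + 2 * c) (s≤s z≤n) (core c (suc f))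

module _ (c : ℕ) where

  upper lower : ℕ → ℕ
  upper b = 4 + (c ⊓ b)
  lower b = 3 + (c ⊓ b)

  -- Up to block `c` the factor of `upper` is the next factor of `lower`.
  telescope : ∀ K → K ≤ suc c → 3 * prod upper K ≡ (3 + K) * prod lower K
  telescope zero    _  = refl
  telescope (suc K) le rewrite m≥n⇒m⊓n≡n (s≤s⁻¹ le) = begin
    3 * (prod upper K * (4 + K))        ≡⟨ sym (*-assoc 3 (prod upper K) _) ⟩
    3 * prod upper K * (4 + K)          ≡⟨ cong (_* (4 + K)) (telescope K (≤-trans (n≤1+n K) le)) ⟩
    (3 + K) * prod lower K * (4 + K)    ≡⟨ exchange (3 + K) (prod lower K) (4 + K) ⟩
    (4 + K) * (prod lower K * (3 + K))  ∎
    where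
    open ≡-Reasoning
    exchange : ∀ a b c → a * b * c ≡ c * (b * a)
    exchange = solve-∀

  constant : ∀ (f : ℕ → ℕ) y → (∀ b → c ≤ b → f b ≡ y) → ∀ e → prod f (e + suc c) ≡ y ^ e * prod f (suc c)
  constant f y eq zero    = sym (+-identityʳ _)
  constant f y eq (suc e) = begin
    prod f (e + suc c) * f (e + suc c)  ≡⟨ cong₂ _*_ (constant f y eq e) (eq (e + suc c) (≤-trans (n≤1+n c) (m≤n+m (suc c) e))) ⟩
    y ^ e * prod f (suc c) * y          ≡⟨ exchange (y ^ e) (prod f (suc c)) y ⟩
    y * y ^ e * prod f (suc c)          ∎
    where
    open ≡-Reasoning
    exchange : ∀ a b c → a * b * c ≡ c * a * b
    exchange = solve-∀

  -- The quotients of `upper` by `lower` telescope to (4 + c) / 3 over the first `suc c` blocks and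
  -- equal (4 + c) / (3 + c) in each later one; `core` is what remains.
  block-bound : ∀ f → (2 + (c + (f + 2 * c))) * prod lower (f + 2 * c + suc c) ≤ 2 * prod upper (f + 2 * c + suc c)
  block-bound f = *-cancelˡ-≤ 3 (begin
    3 * ((2 + (c + e)) * prod lower (e + suc c))
      ≡⟨ cong (λ t → 3 * ((2 + (c + e)) * t)) (constant lower (3 + c) (λ b le → cong (3 +_) (m≤n⇒m⊓n≡m le)) e) ⟩
    3 * ((2 + (c + e)) * ((3 + c) ^ e * lo))
      ≡⟨ regroup (2 + (c + e)) ((3 + c) ^ e) lo ⟩
    3 * (2 + (c + e)) * (3 + c) ^ e * lo
      ≤⟨ *-monoˡ-≤ lo (core c f) ⟩
    2 * ((4 + c) * (4 + c) ^ e) * lo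
      ≡⟨ regroup′ (4 + c) ((4 + c) ^ e) lo ⟩
    2 * ((4 + c) ^ e * ((4 + c) * lo))
      ≡⟨ cong (λ t → 2 * ((4 + c) ^ e * t)) (sym (telescope (suc c) ≤-refl)) ⟩
    2 * ((4 + c) ^ e * (3 * prod upper (suc c)))
      ≡⟨ regroup″ ((4 + c) ^ e) (prod upper (suc c)) ⟩
    3 * (2 * ((4 + c) ^ e * prod upper (suc c)))
      ≡⟨ cong (λ t → 3 * (2 * t)) (sym (constant upper (4 + c) (λ b le → cong (4 +_) (m≤n⇒m⊓n≡m le)) e)) ⟩
    3 * (2 * prod upper (e + suc c)) ∎)
    where
    open ≤-Reasoning
    e lo : ℕ
    e = f + 2 * c
    lo = prod lower (suc c)
    regroup : ∀ a b d → 3 * (a * (b * d)) ≡ 3 * a * b * d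
    regroup = solve-∀
    regroup′ : ∀ a b d → 2 * (a * b) * d ≡ 2 * (b * (a * d))
    regroup′ = solve-∀
    regroup″ : ∀ a b → 2 * (a * (3 * b)) ≡ 3 * (2 * (a * b))
    regroup″ = solve-∀

module Levels (n k₂ : ℕ) (3≤n : 3 ≤ suc n) where

  -- Depends on the rank only until the rank reaches the number of letters.
  level : ℕ → ℕ
  level j = (k₂ ⊓ j) / suc n

  -- The quotient `A d / B d` is the product of L / (L - 1) over the dimensions below `d`, with L
  -- the value `4 + level j`.
  A B : ℕ → ℕ
  A = prod (λ j → 4 + level j)
  B = prod (λ j → 3 + level j)

  c : ℕ
  c = k₂ / suc n

  level-block : ∀ i K → i < suc n → level (i + K * suc n) ≡ c ⊓ K
  level-block i K i<n = trans (⊓-/ k₂ (i + K * suc n)) (cong (c ⊓_) (trans (+-distrib-/-∣ʳ i (divides-refl K)) (cong₂ _+_ (m<n⇒m/n≡0 i<n) (m*n/n≡m K (suc n)))))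
    where
    open import Data.Nat.Divisibility using (divides-refl)
    ⊓-/ : ∀ a b → (a ⊓ b) / suc n ≡ (a / suc n) ⊓ (b / suc n)
    ⊓-/ a b with ≤-total a b
    ... | inj₁ le = trans (cong (_/ suc n) (m≤n⇒m⊓n≡m le)) (sym (m≤n⇒m⊓n≡m (/-monoˡ-≤ (suc n) le)))
    ... | inj₂ le = trans (cong (_/ suc n) (m≥n⇒m⊓n≡n le)) (sym (m≥n⇒m⊓n≡n (/-monoˡ-≤ (suc n) le)))

  -- The level is constant on each run of `suc n` consecutive dimensions, so every block contributes
  -- a power.
  blocks : ∀ (F : ℕ → ℕ) K → prod (F ∘ level) (K * suc n) ≡ prod (λ b → F (c ⊓ b)) K ^ suc n
  blocks F zero    = sym (^-zeroˡ (suc n))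
  blocks F (suc K) = trans (run (suc n) ≤-refl) (trans (cong (_* F (c ⊓ K) ^ suc n) (blocks F K)) (sym (^-distribʳ-* (suc n) (prod (λ b → F (c ⊓ b)) K) (F (c ⊓ K)))))
    where
    run : ∀ m → m ≤ suc n → prod (F ∘ level) (m + K * suc n) ≡ prod (F ∘ level) (K * suc n) * F (c ⊓ K) ^ m
    run zero    _  = sym (*-identityʳ _)
    run (suc m) le = trans (cong₂ _*_ (run m (≤-trans (n≤1+n m) le)) (cong F (level-block m K le)))
      (exchange (prod (F ∘ level) (K * suc n)) (F (c ⊓ K) ^ m) (F (c ⊓ K)))
      where
      exchange : ∀ a b c → a * b * c ≡ a * (c * b)
      exchange = solve-∀

  -- Three positions are needed here: the constant tail in `block-bound` must have at least `2 * c`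
  -- blocks.
  3c≤k₂ : 3 * c ≤ k₂
  3c≤k₂ = ≤-trans (≤-trans (*-monoˡ-≤ c 3≤n) (≤-reflexive (*-comm (suc n) c))) (m/n*n≤m k₂ (suc n))

  D : ℕ
  D = suc n * suc k₂

  -- Both sides are powers with exponent `suc n`, one factor for each dimension of a block;
  -- comparing the bases reduces the claim to `block-bound`.
  start : (2 + k₂) ^ suc n * 2 ^ D * B D ≤ 2 ^ (suc n * (2 + k₂)) * A D
  start = begin
    (2 + k₂) ^ suc n * 2 ^ D * B D
      ≡⟨ cong₂ (λ x y → (2 + k₂) ^ suc n * x * y) (sym (2^)) (trans (cong B (*-comm (suc n) (suc k₂))) (blocks (3 +_) (suc k₂))) ⟩
    (2 + k₂) ^ suc n * (2 ^ suc k₂) ^ suc n * lo ^ suc n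
      ≡⟨ sym (trans (^-distribʳ-* (suc n) ((2 + k₂) * 2 ^ suc k₂) lo) (cong (_* lo ^ suc n) (^-distribʳ-* (suc n) (2 + k₂) (2 ^ suc k₂)))) ⟩
    ((2 + k₂) * 2 ^ suc k₂ * lo) ^ suc n
      ≤⟨ ^-monoˡ-≤ (suc n) base ⟩
    (2 ^ (2 + k₂) * up) ^ suc n
      ≡⟨ ^-distribʳ-* (suc n) (2 ^ (2 + k₂)) up ⟩
    (2 ^ (2 + k₂)) ^ suc n * up ^ suc n
      ≡⟨ cong₂ _*_ (trans (^-*-assoc 2 (2 + k₂) (suc n)) (cong (2 ^_) (*-comm (2 + k₂) (suc n)))) (sym (trans (cong A (*-comm (suc n) (suc k₂))) (blocks (4 +_) (suc k₂)))) ⟩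
    2 ^ (suc n * (2 + k₂)) * A D ∎
    where
    open ≤-Reasoning
    up lo f : ℕ
    up = prod (upper c) (suc k₂)
    lo = prod (lower c) (suc k₂)
    f = k₂ ∸ 3 * c
    2^ : (2 ^ suc k₂) ^ suc n ≡ 2 ^ D
    2^ = trans (^-*-assoc 2 (suc k₂) (suc n)) (cong (2 ^_) (*-comm (suc k₂) (suc n)))
    k₂≡ : c + (f + 2 * c) ≡ k₂
    k₂≡ = trans (collect c f) (m∸n+n≡m 3c≤k₂)
      where
      collect : ∀ c f → c + (f + 2 * c) ≡ f + 3 * c
      collect = solve-∀
    K≡ : f + 2 * c + suc c ≡ suc k₂
    K≡ = trans (collect (f + 2 * c) c) (cong suc k₂≡)
      where
      collect : ∀ a c → a + suc c ≡ suc (c + a)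
      collect = solve-∀
    block : (2 + k₂) * lo ≤ 2 * up
    block = subst₂ (λ x K → (2 + x) * prod (lower c) K ≤ 2 * prod (upper c) K) k₂≡ K≡ (block-bound c f)
    base : (2 + k₂) * 2 ^ suc k₂ * lo ≤ 2 ^ (2 + k₂) * up
    base = begin
      (2 + k₂) * 2 ^ suc k₂ * lo     ≡⟨ exchange (2 + k₂) (2 ^ suc k₂) lo ⟩
      2 ^ suc k₂ * ((2 + k₂) * lo)   ≤⟨ *-monoʳ-≤ (2 ^ suc k₂) block ⟩
      2 ^ suc k₂ * (2 * up)          ≡⟨ exchange′ (2 ^ suc k₂) up ⟩
      2 * 2 ^ suc k₂ * up            ∎
      where
      exchange : ∀ a b c → a * b * c ≡ b * (a * c)
      exchange = solve-∀
      exchange′ : ∀ a b → a * (2 * b) ≡ 2 * a * b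
      exchange′ = solve-∀

-- Decrease of the potential

length-cartesianProductWith : {X Y Z : Set} (f : X → Y → Z) (xs : List X) (ys : List Y) →
  length (cartesianProductWith f xs ys) ≡ length xs * length ys
length-cartesianProductWith f []       ys = refl
length-cartesianProductWith f (x ∷ xs) ys = trans (length-++ (map (f x) ys))
  (cong₂ _+_ (length-map (f x) ys) (length-cartesianProductWith f xs ys))

length-allCodes : ∀ n k → length (allCodes n k) ≡ k ^ n
length-allCodes zero    k = refl
length-allCodes (suc n) k = trans (length-cartesianProductWith _∷_ (allFin k) (allCodes n k))
  (cong₂ _*_ (length-tabulate {n = k} id) (length-allCodes n k))

module _ {n k₂ : ℕ} (3≤n : 3 ≤ suc n) where
  open Levels n k₂ 3≤n
  open Minimax blackWhite allowed (suc n) (2 + k₂)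
  open Game blackWhite allowed (suc n) (2 + k₂)

  -- r bounds d + log₂ |S| − log₂ ∏ (1 − 1 / L j)⁻¹ from above, the product extending over j < d, where
  -- L j = 4 + level j: a set of rank j + 1 loses a fraction 1 / L j unless the response halves it.
  Potential : List (Code (suc n) (2 + k₂)) → ℕ → Set
  Potential S r = ∃[ d ] (RankLe S d × length S * 2 ^ d * B d ≤ 2 ^ r * A d)

  A≤ : ∀ d → A d ≤ 2 ^ d * B d
  A≤ zero    = ≤-refl
  A≤ (suc d) = ≤-trans (*-mono-≤ (A≤ d) (double (level d))) (≤-reflexive (interchange (2 ^ d) (B d) (3 + level d)))
    where
    double : ∀ l → 4 + l ≤ 2 * (3 + l)
    double l = ≤-trans (m≤m+n (4 + l) (2 + l)) (≤-reflexive (expand l))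
      where
      expand : ∀ l → (4 + l) + (2 + l) ≡ 2 * (3 + l)
      expand = solve-∀
    interchange : ∀ a b l → a * b * (2 * l) ≡ 2 * a * (b * l)
    interchange = solve-∀

  A>0 : ∀ d → 0 < A d
  A>0 zero    = s≤s z≤n
  A>0 (suc d) = *-mono-≤ (A>0 d) (s≤s (z≤n {3 + level d}))

  -- Each dimension contributes 1 - log₂ (L / (L - 1)) ≥ 0 and two codes contribute at least 1, so
  -- the potential is positive.
  no-potential : ∀ s d → 2 ≤ s → ¬ (s * 2 ^ d * B d ≤ 2 ^ 0 * A d)
  no-potential s d 2≤ le = <⇒≱ (A>0 d) (+-cancelˡ-≤ (A d) _ _ (begin
    A d + A d                      ≡⟨ cong (A d +_) (sym (+-identityʳ _)) ⟩
    2 * A d                        ≤⟨ *-monoʳ-≤ 2 (A≤ d) ⟩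
    2 * (2 ^ d * B d)              ≤⟨ *-monoˡ-≤ (2 ^ d * B d) 2≤ ⟩
    s * (2 ^ d * B d)       ≡⟨ sym (*-assoc (s) _ _) ⟩
    s * 2 ^ d * B d         ≤⟨ le ⟩
    1 * A d                        ≡⟨ trans (+-identityʳ (A d)) (sym (+-identityʳ (A d))) ⟩
    A d + 0                        ∎))
    where open ≤-Reasoning

  module _ {S Q H} (s : Step S Q H) where
    open Step s

    M g : ℕ
    M = score S Q
    g = length S ∸ M

    M+g : M + g ≡ length S
    M+g = m+[n∸m]≡n (<⇒≤ score<)

    response : Code (suc n) (2 + k₂) → ℕ × ℕ
    response Q′ = proj₁ (score-≤ Q′ tt)

    β μ : Code (suc n) (2 + k₂) → ℕ
    β Q′ = proj₁ (response Q′)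
    μ Q′ = proj₁ (response Q′) + proj₂ (response Q′)

    -- By minimality every query has a class of at least `M` codes, which leaves at most `g` others.
    few : ∀ Q′ → count (exceptional? β μ Q′) S ≤ g
    few Q′ = ≤-trans (count-mono (exceptional? β μ Q′) (¬? ∘ In) S (λ {h} _ exc eq → exc (usual h eq)))
      (+-cancelˡ-≤ M _ _ (begin
        M + count (¬? ∘ In) S          ≤⟨ +-monoˡ-≤ _ (≤-trans (proj₂ (score-≤ Q′ tt)) (≤-reflexive (count≡length-filter In S))) ⟩
        count In S + count (¬? ∘ In) S ≡⟨ count-¬ In S ⟩
        length S                       ≡⟨ sym M+g ⟩
        M + g                          ∎))
      where
      open ≤-Reasoning
      In : ∀ h → Dec (Δ blackWhite Q′ h ≡ response Q′)
      In h = Δ blackWhite Q′ h ≟ᴿ response Q′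
      usual : ∀ h → Δ blackWhite Q′ h ≡ response Q′ → matches Q′ h ≡ β Q′ × common Q′ h ≡ μ Q′
      usual h eq = trans (sym (blackPegs≡matches Q′ h)) (cong proj₁ eq) ,
        trans (sym (total≡common Q′ h)) (trans (sym (m+[n∸m]≡n (black≤total Q′ h))) (cong₂ _+_ (cong proj₁ eq) (cong proj₂ eq)))

    -- If `4 * g` reaches the size of `S`, nothing more is needed, the factor being at least 4.
    -- Otherwise the responses are concentrated.
    excess : ∀ {d} → RankLe S (suc d) → length S ≤ (4 + level d) * g
    excess {d} rk = go (4 * g <? length S)
      where
      go : Dec (4 * g < length S) → length S ≤ (4 + level d) * g
      go (yes quiet) = quiet-bound ≤-refl zero (suc zero) (λ ()) S unique 2≤ rk g β μ quiet few
      go (no ¬quiet) = ≤-trans (≮⇒≥ ¬quiet) (*-monoˡ-≤ g (m≤m+n 4 (level d)))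

    shrink : ∀ {d} → RankLe S (suc d) → length next * (4 + level d) ≤ length S * (3 + level d)
    shrink {d} rk = ≤-trans (*-monoˡ-≤ (4 + level d) next≤score) (+-cancelʳ-≤ (length S) _ _ (begin
      M * (4 + level d) + length S                  ≤⟨ +-monoʳ-≤ (M * (4 + level d)) (excess rk) ⟩
      M * (4 + level d) + (4 + level d) * g         ≡⟨ collect M g (level d) ⟩
      (M + g) * (3 + level d) + (M + g)             ≡⟨ cong (λ t → t * (3 + level d) + t) M+g ⟩
      length S * (3 + level d) + length S           ∎))
      where
      open ≤-Reasoning
      collect : ∀ M g l → M * (4 + l) + (4 + l) * g ≡ (M + g) * (3 + l) + (M + g)
      collect = solve-∀

    halved : ∀ {d r} → length next + length next ≤ length S →
      length S * 2 ^ d * B d ≤ 2 ^ suc r * A d → length next * 2 ^ d * B d ≤ 2 ^ r * A d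
    halved {d} {r} half le = *-cancelˡ-≤ 2 (begin
      2 * (length next * 2 ^ d * B d)                ≡⟨ collect (length next) (2 ^ d) (B d) ⟩
      (length next + length next) * 2 ^ d * B d      ≤⟨ *-monoˡ-≤ (B d) (*-monoˡ-≤ (2 ^ d) half) ⟩
      length S * 2 ^ d * B d                         ≤⟨ le ⟩
      2 * 2 ^ r * A d                                ≡⟨ *-assoc 2 (2 ^ r) (A d) ⟩
      2 * (2 ^ r * A d)                              ∎)
      where
      open ≤-Reasoning
      collect : ∀ a b c → 2 * (a * b * c) ≡ (a + a) * b * c
      collect = solve-∀

    -- Lowering the rank removes a factor 2 and restores the factor L / (L - 1); the smaller set
    -- given by `shrink` pays for the latter.
    dropped : ∀ {d r} → RankLe S (suc d) →
      length S * 2 ^ suc d * B (suc d) ≤ 2 ^ suc r * A (suc d) → length next * 2 ^ d * B d ≤ 2 ^ r * A d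
    dropped {d} {r} rk le = *-cancelʳ-≤ _ _ (2 * (4 + level d)) (begin
      length next * 2 ^ d * B d * (2 * (4 + level d))     ≡⟨ collect (length next) (2 ^ d) (B d) (4 + level d) ⟩
      length next * (4 + level d) * (2 * 2 ^ d * B d)     ≤⟨ *-monoˡ-≤ (2 * 2 ^ d * B d) (shrink rk) ⟩
      length S * (3 + level d) * (2 * 2 ^ d * B d)        ≡⟨ collect′ (length S) (3 + level d) (2 * 2 ^ d) (B d) ⟩
      length S * (2 * 2 ^ d) * (B d * (3 + level d))      ≤⟨ le ⟩
      2 * 2 ^ r * (A d * (4 + level d))                   ≡⟨ collect″ (2 ^ r) (A d) (4 + level d) ⟩
      2 ^ r * A d * (2 * (4 + level d))                   ∎)
      where
      open ≤-Reasoning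
      collect : ∀ a b c l → a * b * c * (2 * l) ≡ a * l * (2 * b * c)
      collect = solve-∀
      collect′ : ∀ a l b c → a * l * (b * c) ≡ a * b * (c * l)
      collect′ = solve-∀
      collect″ : ∀ a b l → 2 * a * (b * l) ≡ a * b * (2 * l)
      collect″ = solve-∀

    decrease : ∀ {r} → Potential S r → ∃[ r′ ] (r ≡ suc r′ × Potential next r′)
    decrease {zero}  (d , _ , le) = contradiction le (no-potential (length S) d 2≤)
    decrease {suc r} (d , rk , le) = r , refl , go (length next + length next ≤? length S)
      where
      go : Dec (length next + length next ≤ length S) → Potential next r
      go (yes half) = d , rank-⊆ rk next⊆ , halved {d} {r} half le
      go (no ¬half) = let d′ , eq , rk′ = majority-drop s (≰⇒> ¬half) rk in
        d′ , rk′ , dropped {d′} {r} (subst (RankLe S) eq rk) (subst (λ d → length S * 2 ^ d * B d ≤ 2 ^ suc r * A d) eq le)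

  initial : ∀ S → length S ≤ (2 + k₂) ^ suc n → Potential S (suc n * (2 + k₂))
  initial S le = D , rank-total S , ≤-trans (*-monoˡ-≤ (B D) (*-monoˡ-≤ (2 ^ D) le)) start

-- All variants together

linear-run : ∀ {φ ρ n k} →
  (∀ {S Q H d} (s : Minimax.Step φ ρ n (suc k) S Q H) → RankLe S d → ∃[ d′ ] (d ≡ suc d′ × RankLe (Minimax.Step.next s) d′)) →
  (H : Code n (suc k)) → Valid ρ H → (Q : ℕ → Code n (suc k)) → Game.IsMinimaxRun φ ρ n (suc k) H Q →
  ∃[ t ] (t ≤ n * suc k × Game.Identified φ ρ n (suc k) H Q t)
linear-run {φ} {ρ} {n} {k} step H validH Q run =
  let t , t≤ , id = Minimax.Run.loop φ ρ n (suc k) H validH Q run RankLe step (n * k) 0 (rank-total (Game.remaining φ ρ n (suc k) H Q 0))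
  in t , ≤-trans t≤ (*-monoʳ-≤ n (n≤1+n k)) , id

one-letter : ∀ {n} (v w : Code n 1) → v ≡ w
one-letter []         []         = refl
one-letter (zero ∷ v) (zero ∷ w) = cong (zero ∷_) (one-letter v w)

one-letter-step : ∀ {φ ρ n} {S Q H d} (s : Minimax.Step φ ρ n 1 S Q H) → RankLe S d →
  ∃[ d′ ] (d ≡ suc d′ × RankLe (Minimax.Step.next s) d′)
one-letter-step {φ} {Q = Q} {H} s _ =
  let h , _ , ne = Minimax.Step.leaves s in contradiction (cong (Δ φ Q) (one-letter h H)) ne

long-run : ∀ {n k₂} → 3 ≤ suc n →
  (H : Code (suc n) (2 + k₂)) → Valid allowed H → (Q : ℕ → Code (suc n) (2 + k₂)) → Game.IsMinimaxRun blackWhite allowed (suc n) (2 + k₂) H Q →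
  ∃[ t ] (t ≤ suc n * (2 + k₂) × Game.Identified blackWhite allowed (suc n) (2 + k₂) H Q t)
long-run {n} {k₂} 3≤n H validH Q run =
  Minimax.Run.loop blackWhite allowed (suc n) (2 + k₂) H validH Q run (Potential 3≤n) (λ s → decrease 3≤n s) (suc n * (2 + k₂)) 0
    (initial 3≤n (Game.remaining blackWhite allowed (suc n) (2 + k₂) H Q 0)
      (≤-trans (length-filter (Game.consistent? blackWhite allowed (suc n) (2 + k₂) H Q 0) (𝒱 allowed (suc n) (2 + k₂)))
        (≤-trans (length-filter (valid? allowed) (allCodes (suc n) (2 + k₂))) (≤-reflexive (length-allCodes (suc n) (2 + k₂))))))

allowed-run : ∀ n k (H : Code n (suc k)) → Valid allowed H → (Q : ℕ → Code n (suc k)) → Game.IsMinimaxRun blackWhite allowed n (suc k) H Q →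
  ∃[ t ] (t ≤ n * suc k × Game.Identified blackWhite allowed n (suc k) H Q t)
-- A single letter is treated apart, since the coins need two different letters.
allowed-run n zero = linear-run one-letter-step
allowed-run 0 (suc k₂) = linear-run (short-step z≤n)
allowed-run 1 (suc k₂) = linear-run (short-step (s≤s z≤n))
allowed-run 2 (suc k₂) = linear-run (short-step ≤-refl)
allowed-run (suc (suc (suc n))) (suc k₂) = long-run (s≤s (s≤s (s≤s z≤n)))

theorem2 : (n k : ℕ) → 1 ≤ n → 1 ≤ k →
    (φ : Feedback) (ρ : Repetitions) → (ρ ≡ notAllowed → n ≤ k) →
    (H : Code n k) → Valid ρ H →
    (Q : ℕ → Code n k) → Game.IsMinimaxRun φ ρ n k H Q →
    ∃[ t ] (t ≤ n * k × Game.Identified φ ρ n k H Q t)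
theorem2 n (suc k) _ _ black      ρ          _ H validH Q run = linear-run black-step H validH Q run
theorem2 n (suc k) _ _ blackWhite notAllowed _ H validH Q run = linear-run notAllowed-step H validH Q run
theorem2 n (suc k) _ _ blackWhite allowed    _ H validH Q run = allowed-run n k H validH Q run
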